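{- Let $\mathcal{A}$ be a finite real linear hyperplane arrangement of rank $r\le3$. Then $P_{\mathcal{A}}(z)$ is real-rooted.
   Context: Flats of $\mathcal{A}$ are intersections of subsets of its hyperplanes, forming a lattice under inclusion with minimum $\bot=\bigcap\mathcal{A}$ and Möbius function $\mu$; the rank of $\mathcal{A}$ is the rank of this lattice (the codimension of $\bot$). $P_{\mathcal{A}}(z)=\sum_{\mathrm{X}}|\mu(\bot,\mathrm{X})|(z-1)^{\operatorname{codim}\mathrm{X}}$. No simpliciality is assumed. -}

module Defs where

open import Algebra.Bundles using (CommutativeRing; RawRing)
import Algebra.Definitions.RawSemiring
import Algebra.Properties.CommutativeMonoid.Sum
import Algebra.Properties.Group
import Algebra.Properties.Ring
import Algebra.Properties.Semiring.Sum
open import Data.Bool.Base using (if_then_else_)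
open import Data.Empty using (⊥-elim)
open import Data.Fin.Base using (Fin; zero; suc; punchIn)
open import Data.Fin.Induction using (po-wellFounded)
import Data.Fin.Properties as Fin
open import Data.Fin.Subset using (Subset; inside; outside; _∈_) renaming (⊤ to full)
open import Data.Fin.Subset.Properties using (_∈?_)
open import Data.Integer.Base as ℤ using (ℤ; 0ℤ; 1ℤ)
import Data.Integer.Properties as ℤ
open import Data.List.Base as List using (List; [_]; _++_; deduplicate; length)
open import Data.List.Relation.Unary.Any as Any using (Any; here)
import Data.List.Relation.Unary.Any.Properties as Any
open import Data.Nat.Base using (ℕ; zero; suc; _∸_)
open import Data.Product.Base using (∃; _×_; _,_; proj₁; proj₂)
open import Data.Vec.Base using ([]; _∷_; here; there)
open import Data.Vec.Functional using (Vector; insertAt)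
open import Data.Vec.Functional.Properties using (insertAt-lookup; insertAt-punchIn)
open import Function.Base using (_∘_)
open import Induction.WellFounded using (Acc; acc)
open import Level using (Level; _⊔_) renaming (suc to lsuc)
open import Relation.Binary.Core using (Rel)
open import Relation.Binary.Definitions using (Decidable)
open import Relation.Binary.PropositionalEquality.Core using (_≡_; refl; cong) renaming (sym to ≡-sym)
open import Relation.Binary.Structures using (IsStrictTotalOrder; IsDecPartialOrder)
import Relation.Binary.Construct.NonStrictToStrict as ToStrict
import Relation.Binary.Reasoning.Setoid
open import Relation.Nullary.Decidable using (Dec; yes; no; does; map′; ¬?; _×-dec_; _→-dec_)
open import Relation.Nullary.Negation using (¬_)
open import Relation.Unary using (Pred; _⊆_; _≐_)
open import Relation.Unary.Properties using (⊆-trans; ≐-refl; ≐-sym; ≐-trans)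

record OrderedField c ℓ₁ ℓ₂ : Set (lsuc (c ⊔ ℓ₁ ⊔ ℓ₂)) where
  field
    commutativeRing : CommutativeRing c ℓ₁
  open CommutativeRing commutativeRing public
  infix 4 _<_
  field
    _<_                : Rel Carrier ℓ₂
    isStrictTotalOrder : IsStrictTotalOrder _≈_ _<_
    0≉1                : ¬ 0# ≈ 1#
    inverse            : ∀ x → ¬ x ≈ 0# → ∃ λ y → y * x ≈ 1#
    +-monoˡ-<          : ∀ {x y} z → x < y → x + z < y + z
    *-pos              : ∀ {x y} → 0# < x → 0# < y → 0# < x * y

  open IsStrictTotalOrder isStrictTotalOrder public using (_≟_; compare)

  _UpperBoundOf_ : ∀ {p} → Carrier → Pred Carrier p → Set (c ⊔ ℓ₂ ⊔ p)
  b UpperBoundOf S = ∀ x → S x → ¬ b < x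

  _SupremumOf_ : ∀ {p} → Carrier → Pred Carrier p → Set (c ⊔ ℓ₂ ⊔ p)
  s SupremumOf S = s UpperBoundOf S × (∀ b → b UpperBoundOf S → ¬ b < s)

-- The Dedekind-complete ordered field, i.e. the classical real numbers: this
-- axiomatisation is categorical, and trichotomy of _<_ makes _≈_ decidable.
record CompleteOrderedField c ℓ₁ ℓ₂ : Set (lsuc (c ⊔ ℓ₁ ⊔ ℓ₂)) where
  field
    orderedField : OrderedField c ℓ₁ ℓ₂
  open OrderedField orderedField public
  field
    supremum : (S : Pred Carrier (c ⊔ ℓ₁ ⊔ ℓ₂)) →
               ∃ S → ∃ (_UpperBoundOf S) → ∃ (_SupremumOf S)

module Möbius {N : ℕ} {a b : Level} {_≈_ : Rel (Fin N) a} {_≤_ : Rel (Fin N) b}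
              (isDecPartialOrder : IsDecPartialOrder _≈_ _≤_) where

  open IsDecPartialOrder isDecPartialOrder using (isPartialOrder; _≟_; _≤?_)
  open ToStrict _≈_ _≤_ using (_<_; <-decidable)
  open Algebra.Properties.CommutativeMonoid.Sum ℤ.+-0-commutativeMonoid using (sum)

  _<?_ : Decidable _<_
  _<?_ = <-decidable _≟_ _≤?_

  -- μ(x,x) = 1 and μ(x,y) = - ∑ { μ(x,z) ∣ x ≤ z < y } for x ≠ y, so that
  -- μ(x,y) = 0 unless x ≤ y.
  μ-acc : ∀ x y → Acc _<_ y → ℤ
  μ-acc x y (acc below) = if does (x ≟ y) then 1ℤ else ℤ.- sum term
    where
    term : Fin N → ℤ
    term z with x ≤? z | z <? y
    ... | yes _ | yes z<y = μ-acc x z (below z<y)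
    ... | yes _ | no _    = 0ℤ
    ... | no _  | _       = 0ℤ

  μ : Fin N → Fin N → ℤ
  μ x y = μ-acc x y (po-wellFounded isPartialOrder y)

subsets : ∀ m → List (Subset m)
subsets zero    = [ [] ]
subsets (suc m) = List.map (inside ∷_) (subsets m) ++ List.map (outside ∷_) (subsets m)

subsets-full : ∀ m → Any (full ≡_) (subsets m)
subsets-full zero    = here refl
subsets-full (suc m) = Any.++⁺ˡ (Any.map⁺ (Any.map (cong (inside ∷_)) (subsets-full m)))

module LinearAlgebra {c ℓ₁ ℓ₂ : Level} (F : OrderedField c ℓ₁ ℓ₂) where

  open OrderedField F hiding (zero) renaming (refl to ≈-refl)
  open Algebra.Properties.Semiring.Sum semiring
  open Algebra.Properties.Ring ring using (-‿distribˡ-*; -‿distribʳ-*)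
  open Algebra.Properties.Group +-group using (inverseʳ-unique)
  open Relation.Binary.Reasoning.Setoid setoid

  infix 8 _·_
  _·_ : ∀ {n} → Vector Carrier n → Vector Carrier n → Carrier
  f · x = sum λ k → f k * x k

  lin : ∀ {n d} → Vector Carrier d → (Fin d → Vector Carrier n) → Vector Carrier n
  lin a v k = sum λ i → a i * v i k

  record Basis {n} (W : Pred (Vector Carrier n) ℓ₁) (d : ℕ) : Set (c ⊔ ℓ₁) where
    field
      vector      : Fin d → Vector Carrier n
      member      : ∀ i → W (vector i)
      independent : ∀ a → (∀ k → lin a vector k ≈ 0#) → ∀ i → a i ≈ 0#
      spanning    : ∀ x → W x → ∃ λ a → ∀ k → lin a vector k ≈ x k

  Solutions : ∀ {m n} → (Fin m → Vector Carrier n) → Subset m → Pred (Vector Carrier n) ℓ₁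
  Solutions f S x = ∀ i → i ∈ S → f i · x ≈ 0#

  swap-* : ∀ x y z → x * (y * z) ≈ y * (x * z)
  swap-* x y z = trans (sym (*-assoc x y z)) (trans (*-congʳ (*-comm x y)) (*-assoc y x z))

  ·-lin : ∀ {n d} f (a : Vector Carrier d) (v : Fin d → Vector Carrier n) →
          f · lin a v ≈ sum λ i → a i * (f · v i)
  ·-lin f a v = begin
    (sum λ k → f k * sum λ i → a i * v i k)     ≈⟨ sum-cong-≋ (λ k → *-distribˡ-sum (f k) (λ i → a i * v i k)) ⟩
    (sum λ k → sum λ i → f k * (a i * v i k))   ≈⟨ ∑-comm (λ k i → f k * (a i * v i k)) ⟩
    (sum λ i → sum λ k → f k * (a i * v i k))   ≈⟨ sum-cong-≋ (λ i → sum-cong-≋ λ k → swap-* (f k) (a i) (v i k)) ⟩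
    (sum λ i → sum λ k → a i * (f k * v i k))   ≈⟨ sum-cong-≋ (λ i → *-distribˡ-sum (a i) (λ k → f k * v i k)) ⟨
    (sum λ i → a i * (f · v i))                 ∎

  ·-+ : ∀ {n} (f x y : Vector Carrier n) r →
        f · (λ k → x k + r * y k) ≈ f · x + r * (f · y)
  ·-+ f x y r = begin
    (sum λ k → f k * (x k + r * y k))            ≈⟨ sum-cong-≋ (λ k → distribˡ (f k) (x k) (r * y k)) ⟩
    (sum λ k → f k * x k + f k * (r * y k))      ≈⟨ ∑-distrib-+ (λ k → f k * x k) (λ k → f k * (r * y k)) ⟩
    f · x + (sum λ k → f k * (r * y k))          ≈⟨ +-congˡ (sum-cong-≋ λ k → swap-* (f k) r (y k)) ⟩
    f · x + (sum λ k → r * (f k * y k))          ≈⟨ +-congˡ (*-distribˡ-sum r (λ k → f k * y k)) ⟨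
    f · x + r * (f · y)                          ∎

  zero-sum : ∀ {d} (t : Vector Carrier d) → (∀ i → t i ≈ 0#) → sum t ≈ 0#
  zero-sum {d} t t≈0 = trans (sum-cong-≋ t≈0) (sum-replicate-zero d)

  δ : ∀ {n} → Fin n → Vector Carrier n
  δ zero    zero    = 1#
  δ zero    (suc _) = 0#
  δ (suc _) zero    = 0#
  δ (suc i) (suc k) = δ i k

  lin-δ : ∀ {n} (a : Vector Carrier n) k → lin a δ k ≈ a k
  lin-δ a zero = trans
    (+-cong (*-identityʳ _) (zero-sum _ λ i → zeroʳ (a (suc i)))) (+-identityʳ _)
  lin-δ a (suc k) = trans (+-cong (zeroʳ _) (lin-δ (a ∘ suc) k)) (+-identityˡ _)

  standardBasis : ∀ {n} {W : Pred (Vector Carrier n) ℓ₁} → (∀ x → W x) → Basis W n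
  standardBasis all = record
    { vector      = δ
    ; member      = λ i → all (δ i)
    ; independent = λ a a≈0 i → trans (sym (lin-δ a i)) (a≈0 i)
    ; spanning    = λ x _ → x , lin-δ x
    }

  -- One elimination step: from a basis of W to one of W ∩ ker f.
  cut : ∀ {n d} {W W′ : Pred (Vector Carrier n) ℓ₁} (f : Vector Carrier n) →
        (∀ {x y} r → W x → W y → W (λ k → x k + r * y k)) →
        (∀ {x} → W x → f · x ≈ 0# → W′ x) →
        (∀ {x} → W′ x → W x × f · x ≈ 0#) →
        Basis W d → ∃ (Basis W′)
  cut {n} {d} {W} {W′} f closed into out B with Fin.any? (λ i → ¬? (f · Basis.vector B i ≟ 0#))
  ... | no all-zero = d , record
    { vector      = vector
    ; member      = λ i → into (member i) (f·v≈0 i)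
    ; independent = independent
    ; spanning    = λ x x∈W′ → spanning x (proj₁ (out x∈W′))
    }
    where
    open Basis B
    f·v≈0 : ∀ i → f · vector i ≈ 0#
    f·v≈0 i with f · vector i ≟ 0#
    ... | yes p = p
    ... | no ¬p = ⊥-elim (all-zero (i , ¬p))
  cut {n} {suc d} {W} {W′} f closed into out B | yes (p , fvₚ≉0) = d , record
    { vector      = w
    ; member      = λ j → into (closed (r j) (member _) (member p)) (f·w≈0 j)
    ; independent = λ a a≈0 j → trans
        (reflexive (≡-sym (insertAt-punchIn a p (sum λ i → a i * r i) j)))
        (independent (lift a) (λ k → trans (sym (lin-w a k)) (a≈0 k)) (punchIn p j))
    ; spanning    = span
    }
    where
    open Basis B

    q : Carrier
    q = proj₁ (inverse (f · vector p) fvₚ≉0)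

    q*fvₚ≈1 : q * (f · vector p) ≈ 1#
    q*fvₚ≈1 = proj₂ (inverse (f · vector p) fvₚ≉0)

    r : Fin d → Carrier
    r j = - (f · vector (punchIn p j) * q)

    w : Fin d → Vector Carrier n
    w j k = vector (punchIn p j) k + r j * vector p k

    f·w≈0 : ∀ j → f · w j ≈ 0#
    f·w≈0 j = begin
      f · w j                                 ≈⟨ ·-+ f (vector (punchIn p j)) (vector p) (r j) ⟩
      y + - (y * q) * (f · vector p)          ≈⟨ +-congˡ (-‿distribˡ-* (y * q) (f · vector p)) ⟨
      y + - (y * q * (f · vector p))          ≈⟨ +-congˡ (-‿cong (*-assoc y q (f · vector p))) ⟩
      y + - (y * (q * (f · vector p)))        ≈⟨ +-congˡ (-‿cong (trans (*-congˡ q*fvₚ≈1) (*-identityʳ y))) ⟩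
      y + - y                                 ≈⟨ -‿inverseʳ y ⟩
      0#                                      ∎
      where
      y : Carrier
      y = f · vector (punchIn p j)

    lift : Vector Carrier d → Vector Carrier (suc d)
    lift a = insertAt a p (sum λ j → a j * r j)

    lin-w : ∀ a k → lin a w k ≈ lin (lift a) vector k
    lin-w a k = begin
      (sum λ j → a j * (u j + r j * vₚ))              ≈⟨ sum-cong-≋ (λ j → trans (distribˡ (a j) (u j) (r j * vₚ)) (+-congˡ (sym (*-assoc (a j) (r j) vₚ)))) ⟩
      (sum λ j → a j * u j + a j * r j * vₚ)          ≈⟨ ∑-distrib-+ (λ j → a j * u j) (λ j → a j * r j * vₚ) ⟩
      (sum λ j → a j * u j) + (sum λ j → a j * r j * vₚ) ≈⟨ +-comm _ _ ⟩
      (sum λ j → a j * r j * vₚ) + (sum λ j → a j * u j) ≈⟨ +-cong (*-distribʳ-sum vₚ (λ j → a j * r j)) ≈-refl ⟨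
      (sum λ j → a j * r j) * vₚ + (sum λ j → a j * u j) ≈⟨ +-cong
        (*-congʳ (reflexive (insertAt-lookup a p _)))
        (sum-cong-≋ λ j → *-congʳ (reflexive (insertAt-punchIn a p _ j))) ⟨
      lift a p * vₚ + (sum λ j → lift a (punchIn p j) * u j) ≈⟨ sum-remove {i = p} (λ i → lift a i * vector i k) ⟨
      lin (lift a) vector k                           ∎
      where
      vₚ : Carrier
      vₚ = vector p k
      u : Fin d → Carrier
      u j = vector (punchIn p j) k

    span : ∀ x → W′ x → ∃ λ a → ∀ k → lin a w k ≈ x k
    span x x∈W′ = a , λ k → begin
      lin a w k                                       ≈⟨ lin-w a k ⟩
      lin (lift a) vector k                           ≈⟨ sum-remove {i = p} (λ i → lift a i * vector i k) ⟩
      lift a p * vector p k + (sum λ j → lift a (punchIn p j) * vector (punchIn p j) k)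
        ≈⟨ +-cong
             (*-congʳ (trans (reflexive (insertAt-lookup a p _)) pivot))
             (sum-cong-≋ λ j → *-congʳ (reflexive (insertAt-punchIn a p _ j))) ⟩
      b p * vector p k + (sum λ j → b (punchIn p j) * vector (punchIn p j) k)
        ≈⟨ sum-remove {i = p} (λ i → b i * vector i k) ⟨
      lin b vector k                                  ≈⟨ b-spec k ⟩
      x k                                             ∎
      where
      x∈W : W x
      x∈W = proj₁ (out x∈W′)

      b : Vector Carrier (suc d)
      b = proj₁ (spanning x x∈W)

      b-spec : ∀ k → lin b vector k ≈ x k
      b-spec = proj₂ (spanning x x∈W)

      a : Vector Carrier d
      a = b ∘ punchIn p

      y : Fin (suc d) → Carrier
      y i = f · vector i

      rest : Carrier
      rest = sum λ j → a j * y (punchIn p j)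

      vanish : b p * y p + rest ≈ 0#
      vanish = begin
        b p * y p + rest          ≈⟨ sum-remove {i = p} (λ i → b i * y i) ⟨
        (sum λ i → b i * y i)     ≈⟨ ·-lin f b vector ⟨
        f · lin b vector          ≈⟨ sum-cong-≋ (λ k → *-congˡ (b-spec k)) ⟩
        f · x                     ≈⟨ proj₂ (out x∈W′) ⟩
        0#                        ∎

      pivot : (sum λ j → a j * r j) ≈ b p
      pivot = begin
        (sum λ j → a j * r j)                        ≈⟨ sum-cong-≋ (λ j → begin
          a j * - (y (punchIn p j) * q)                ≈⟨ *-congˡ (-‿distribʳ-* (y (punchIn p j)) q) ⟩
          a j * (y (punchIn p j) * - q)                ≈⟨ *-assoc (a j) (y (punchIn p j)) (- q) ⟨
          a j * y (punchIn p j) * - q                  ∎) ⟩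
        (sum λ j → a j * y (punchIn p j) * - q)      ≈⟨ *-distribʳ-sum (- q) (λ j → a j * y (punchIn p j)) ⟨
        rest * - q                                   ≈⟨ *-congʳ (inverseʳ-unique (b p * y p) rest vanish) ⟩
        - (b p * y p) * - q                          ≈⟨ -‿distribˡ-* (b p * y p) (- q) ⟨
        - (b p * y p * - q)                          ≈⟨ -‿cong (-‿distribʳ-* (b p * y p) q) ⟨
        - (- (b p * y p * q))                        ≈⟨ inverseʳ-unique (- (b p * y p * q)) (b p * y p * q) (-‿inverseˡ _) ⟨
        b p * y p * q                                ≈⟨ *-assoc (b p) (y p) q ⟩
        b p * (y p * q)                              ≈⟨ *-congˡ (trans (*-comm (y p) q) q*fvₚ≈1) ⟩
        b p * 1#                                     ≈⟨ *-identityʳ (b p) ⟩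
        b p                                          ∎

  solutions-closed : ∀ {m n} (f : Fin m → Vector Carrier n) S {x y} r →
                     Solutions f S x → Solutions f S y → Solutions f S (λ k → x k + r * y k)
  solutions-closed f S {x} {y} r fx fy i i∈S = begin
    f i · (λ k → x k + r * y k)   ≈⟨ ·-+ (f i) x y r ⟩
    f i · x + r * (f i · y)       ≈⟨ +-cong (fx i i∈S) (*-congˡ (fy i i∈S)) ⟩
    0# + r * 0#                   ≈⟨ +-identityˡ (r * 0#) ⟩
    r * 0#                        ≈⟨ zeroʳ r ⟩
    0#                            ∎

  solutionBasis : ∀ {m n} (f : Fin m → Vector Carrier n) S → ∃ (Basis (Solutions f S))
  solutionBasis {zero}  {n} f []            = n , standardBasis λ _ ()
  solutionBasis {suc m} {n} f (outside ∷ S) = proj₁ B , record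
    { vector      = vector
    ; member      = λ { j (suc i) (there i∈S) → member j i i∈S }
    ; independent = independent
    ; spanning    = λ x fx → spanning x λ i i∈S → fx (suc i) (there i∈S)
    }
    where
    B : ∃ (Basis (Solutions (f ∘ suc) S))
    B = solutionBasis (f ∘ suc) S
    open Basis (proj₂ B)
  solutionBasis {suc m} {n} f (inside ∷ S) = cut (f zero)
    (solutions-closed (f ∘ suc) S)
    (λ { fx f₀x zero here → f₀x ; fx f₀x (suc i) (there i∈S) → fx i i∈S })
    (λ fx → (λ i i∈S → fx (suc i) (there i∈S)) , fx zero here)
    (proj₂ (solutionBasis (f ∘ suc) S))

  solutions-⊆? : ∀ {m n} (f : Fin m → Vector Carrier n) S T →
                 Dec (Solutions f S ⊆ Solutions f T)
  solutions-⊆? f S T = map′ to from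
    (Fin.all? λ j → Fin.all? λ i → (i ∈? T) →-dec (f i · vector j ≟ 0#))
    where
    open Basis (proj₂ (solutionBasis f S))

    to : (∀ j → Solutions f T (vector j)) → Solutions f S ⊆ Solutions f T
    to f·v≈0 {x} fx i i∈T = begin
      f i · x                                  ≈⟨ sum-cong-≋ (λ k → *-congˡ (proj₂ (spanning x fx) k)) ⟨
      f i · lin a vector                       ≈⟨ ·-lin (f i) a vector ⟩
      (sum λ j → a j * (f i · vector j))       ≈⟨ zero-sum _ (λ j → trans (*-congˡ (f·v≈0 j i i∈T)) (zeroʳ (a j))) ⟩
      0#                                       ∎
      where
      a : Vector Carrier _
      a = proj₁ (spanning x fx)

    from : Solutions f S ⊆ Solutions f T → ∀ j → Solutions f T (vector j)
    from S⊆T j = S⊆T (member j)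

module _ {c ℓ₁ ℓ₂ : Level} (F : OrderedField c ℓ₁ ℓ₂) where

  open OrderedField F

  -- Complex numbers, as pairs of real and imaginary part.
  ℂ-rawRing : RawRing c ℓ₁
  ℂ-rawRing = record
    { Carrier = Carrier × Carrier
    ; _≈_     = λ (x , y) (x′ , y′) → x ≈ x′ × y ≈ y′
    ; _+_     = λ (x , y) (x′ , y′) → x + x′ , y + y′
    ; _*_     = λ (x , y) (x′ , y′) → x * x′ - y * y′ , x * y′ + y * x′
    ; -_      = λ (x , y) → - x , - y
    ; 0#      = 0# , 0#
    ; 1#      = 1# , 0#
    }

  private module ℂ = RawRing ℂ-rawRing

  RealRooted : (ℂ.Carrier → ℂ.Carrier) → Set (c ⊔ ℓ₁)
  RealRooted p = ∀ z → p z ℂ.≈ ℂ.0# → proj₂ z ≈ 0#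

  -- A finite set of linear hyperplanes in Fⁿ, each given by a normal vector.
  -- The enumeration may repeat a hyperplane: the set of flats ignores this.
  record Arrangement (n : ℕ) : Set (c ⊔ ℓ₁) where
    field
      size           : ℕ
      normal         : Fin size → Vector Carrier n
      normal-nonzero : ∀ i → ¬ (∀ k → normal i k ≈ 0#)

module _ {c ℓ₁ ℓ₂ : Level} {F : OrderedField c ℓ₁ ℓ₂} {n : ℕ} (𝒜 : Arrangement F n) where

  open OrderedField F using (Carrier; _≈_; 0#)
  open Arrangement 𝒜
  open LinearAlgebra F

  hyperplane : Fin size → Pred (Vector Carrier n) ℓ₁
  hyperplane i x = normal i · x ≈ 0#

  ⋂ : Subset size → Pred (Vector Carrier n) ℓ₁
  ⋂ S x = ∀ i → i ∈ S → hyperplane i x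

  _⋂⊆?_ : ∀ S T → Dec (⋂ S ⊆ ⋂ T)
  _⋂⊆?_ = solutions-⊆? normal

  _⋂≐?_ : ∀ S T → Dec (⋂ S ≐ ⋂ T)
  S ⋂≐? T = (S ⋂⊆? T) ×-dec (T ⋂⊆? S)

  -- For each flat, exactly one set of hyperplanes whose intersection it is.
  generators : List (Subset size)
  generators = deduplicate _⋂≐?_ (subsets size)

  Flat : Set
  Flat = Fin (length generators)

  space : Flat → Pred (Vector Carrier n) ℓ₁
  space X = ⋂ (List.lookup generators X)

  _≤ᶠ_ : Rel Flat (c ⊔ ℓ₁)
  X ≤ᶠ Y = space X ⊆ space Y

  _≈ᶠ_ : Rel Flat (c ⊔ ℓ₁)
  X ≈ᶠ Y = space X ≐ space Y

  ≤ᶠ-isDecPartialOrder : IsDecPartialOrder _≈ᶠ_ _≤ᶠ_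
  ≤ᶠ-isDecPartialOrder = record
    { isPartialOrder = record
      { isPreorder = record
        { isEquivalence = record
          { refl  = ≐-refl
          ; sym   = ≐-sym
          ; trans = ≐-trans
          }
        ; reflexive = proj₁
        ; trans     = λ {X} {Y} {Z} → ⊆-trans {i = space X} {space Y} {space Z}
        }
      ; antisym = _,_
      }
    ; _≟_  = λ X Y → List.lookup generators X ⋂≐? List.lookup generators Y
    ; _≤?_ = λ X Y → List.lookup generators X ⋂⊆? List.lookup generators Y
    }

  open Möbius ≤ᶠ-isDecPartialOrder public using (μ)

  ⊥-generator : Any (λ S → ⋂ full ≐ ⋂ S) generators
  ⊥-generator = Any.deduplicate⁺ _⋂≐?_
    (λ T≐S full≐S → ≐-trans full≐S (≐-sym T≐S))
    (Any.map (λ { refl → ≐-refl }) (subsets-full size))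

  -- The flat ⋂ full, the intersection of all hyperplanes.
  ⊥ᶠ : Flat
  ⊥ᶠ = Any.index ⊥-generator

  space-basis : ∀ X → ∃ (Basis (space X))
  space-basis X = solutionBasis normal (List.lookup generators X)

  dim : Flat → ℕ
  dim X = proj₁ (space-basis X)

  codim : Flat → ℕ
  codim X = n ∸ dim X

  rank : ℕ
  rank = codim ⊥ᶠ

  private module ℂ where
    open RawRing (ℂ-rawRing F) public
    open Algebra.Definitions.RawSemiring rawSemiring public
      using (sum; _^_) renaming (_×_ to _×ⁿ_)

  P : ℂ.Carrier → ℂ.Carrier
  P z = ℂ.sum λ X → ℤ.∣ μ ⊥ᶠ X ∣ ℂ.×ⁿ ((z ℂ.+ ℂ.- ℂ.1#) ℂ.^ codim X)

{-# OPTIONS --safe #-}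
-- Put w = z − 1.  In rank 3 let a be the number of flats of codimension 2 ("points") and fix a
-- hyperplane H containing k ≥ 1 of them, so that q = a − k points lie off H.  Since ∑ μ(⊥,X) = 0,
-- P = (w + 1) (w² + (a − 1) w + c) with c = |μ(⊥,⊤)|.  A hyperplane y contains |μ(⊥,y)| + 1 points,
-- and if y ≠ H exactly one of them lies on H; counting incidences with the points off H therefore
-- gives c = M − q, where M is the sum over those points p of the number of hyperplanes through p.
-- Distinct hyperplanes through p meet H in distinct points, so M ≤ q k and 4 c ≤ 4 (k − 1) q ≤
-- (k − 1 + q)² = (a − 1)²: the quadratic factor has nonnegative discriminant.  In rank 2, with h
-- hyperplanes, P = (w + 1) (w + h − 1); in rank 1, P = w + 1; in rank 0, P = 1.
module Submission where

open import Algebra.Bundles using (CommutativeMonoid; CommutativeRing; RawRing)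
import Algebra.Construct.DirectProduct as DirectProduct
import Algebra.Definitions.RawSemiring
import Algebra.Properties.AbelianGroup
import Algebra.Properties.CommutativeMonoid.Sum as Sum
import Algebra.Properties.Group
import Algebra.Properties.Monoid.Mult
import Algebra.Properties.Ring
import Algebra.Properties.Semiring.Mult
import Algebra.Properties.Semiring.Mult.TCOptimised
import Algebra.Properties.Semiring.Sum
import Algebra.Solver.Ring
open import Algebra.Solver.Ring.AlmostCommutativeRing using (fromCommutativeRing; _-Raw-AlmostCommutative⟶_)
open import Data.Bool.Base using (if_then_else_)
open import Data.Empty using (⊥-elim)
open import Data.Fin.Base using (Fin; zero; suc; toℕ; fromℕ<)
open import Data.Fin.Induction using (po-wellFounded)
import Data.Fin.Properties as Fin
open import Data.Fin.Subset using (Subset; inside; outside; _∈_; _∪_; ⁅_⁆; ∣_∣) renaming (⊤ to full; ⊥ to ∅)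
open import Data.Fin.Subset.Properties using (_∈?_; ∈⊤; ∉⊥; ∣⊤∣≡n; ∣⊥∣≡0; ∣⁅x⁆∣≡1; x∈⁅x⁆; x∈⁅y⁆⇒x≡y; x∈p∪q⁻; x∈p∪q⁺)
open import Data.Integer.Base as ℤ using (ℤ; 0ℤ; 1ℤ)
import Data.Integer.Properties as ℤ
open import Data.List.Base as List using ()
open import Data.List.Membership.Propositional.Properties using (∈-lookup)
open import Data.List.Relation.Unary.All as All using ()
open import Data.List.Relation.Unary.AllPairs using (AllPairs; _∷_)
open import Data.List.Relation.Unary.Any as Any using (Any; here)
import Data.List.Relation.Unary.Any.Properties as Any
open import Data.List.Relation.Unary.Unique.DecSetoid.Properties using (deduplicate-!)
import Data.Maybe.Base as Maybe
open import Data.Nat.Base as ℕ using (ℕ; zero; suc; _≤_; z≤n; s≤s) renaming (_<_ to _<ℕ_)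
import Data.Nat.Properties as ℕ
open import Data.Nat.Tactic.RingSolver using (solve-∀)
open import Data.Product.Base using (∃; _×_; _,_; proj₁; proj₂)
open import Data.Sum.Base using (_⊎_; inj₁; inj₂)
open import Data.Vec.Base using ([]; _∷_)
open import Data.Vec.Functional using (Vector)
open import Function.Base using (_∘_)
open import Induction.WellFounded using (Acc; acc)
import Level
open import Relation.Binary.Bundles using (DecSetoid)
import Relation.Binary.Construct.NonStrictToStrict as ToStrict
open import Relation.Binary.Core using (Rel)
open import Relation.Binary.Definitions using (Symmetric; tri<; tri≈; tri>)
open import Relation.Binary.PropositionalEquality as ≡ using (_≡_; _≢_)
import Relation.Binary.Reasoning.Setoid
open import Relation.Binary.Structures using (IsDecPartialOrder; IsStrictTotalOrder)
open import Relation.Nullary.Decidable using (Dec; yes; no; does; ¬?; _×-dec_; dec-true; dec-false; dec⇒maybe; decidable-stable)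
open import Relation.Nullary.Negation using (¬_; contradiction)
open import Relation.Unary using (Pred; _⊆_; _≐_)
open import Relation.Unary.Properties using (≐-refl; ≐-sym; ≐-trans)

open import Defs

-- The recursion for μ is signed while `P` uses absolute values, so signs must be settled flat by
-- flat. Atoms carry -1; in rank 3 a hyperplane carries its number of points minus 1, which is
-- nonnegative once it contains a point. This is one reason for `1≤k`: it covers H itself. The last
-- estimate is 4xy ≤ (x + y)² with x = k - 1 and y = q. These always add up to a - 1, so any
-- hyperplane can serve as H and nothing has to be optimised. The discriminant is exploited without
-- square roots: at a zero x + iy with y ≠ 0 the quadratic factor vanishes, and completing the
-- square writes 0 as (2αy)² + (s² - 4αc), a sum of a square and a nonnegative number. Ranks 1 to 3
-- share a single cubic shape in which α may be 0; the price is the extra condition that the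
-- quadratic factor is not identically zero. Rank 0 does not fit, since w + 1 does not divide 1.

module SumProperties {c ℓ} (M : CommutativeMonoid c ℓ) where
  open CommutativeMonoid M
  open Sum M

  sum-zero : ∀ {n} {t : Fin n → Carrier} → (∀ i → t i ≈ ε) → sum t ≈ ε
  sum-zero {n} t≈ε = trans (sum-cong-≋ t≈ε) (sum-replicate-zero n)

  sum-single : ∀ {n} {t : Fin n → Carrier} i → (∀ j → j ≢ i → t j ≈ ε) → sum t ≈ t i
  sum-single {suc n} {t} i t≈ε = trans (sum-remove {i = i} t)
    (trans (∙-congˡ (sum-zero λ j → t≈ε _ λ eq → Fin.punchInᵢ≢i i j eq)) (identityʳ (t i)))

module _ where
  open import Data.Nat.Base hiding (zero; suc; _≤_; z≤n; s≤s)
  open import Data.Nat.Properties hiding (_≟_; _≤?_; _<?_)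
  open import Relation.Binary.PropositionalEquality using (refl; sym; trans; cong; cong₂; subst; module ≡-Reasoning)

  module Σℕ where
    open Algebra.Properties.Semiring.Sum +-*-semiring public
    open SumProperties +-0-commutativeMonoid public

  module Σℤ where
    open Sum ℤ.+-0-commutativeMonoid public
    open SumProperties ℤ.+-0-commutativeMonoid public

  open Σℕ using (sum; *-distribˡ-sum; *-distribʳ-sum)

  -- Finite sums and indicators over the naturals and integers.

  sum-mono-≤ : ∀ {n} {f g : Fin n → ℕ} → (∀ i → f i ≤ g i) → sum f ≤ sum g
  sum-mono-≤ {zero}  f≤g = z≤n
  sum-mono-≤ {suc n} f≤g = +-mono-≤ (f≤g zero) (sum-mono-≤ (f≤g ∘ suc))

  lookup≤sum : ∀ {n} (f : Fin n → ℕ) i → f i ≤ sum f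
  lookup≤sum f zero    = m≤m+n _ _
  lookup≤sum f (suc i) = ≤-trans (lookup≤sum (f ∘ suc) i) (m≤n+m _ _)

  sum-pos : ∀ {n} (f : Fin n → ℕ) → Σℤ.sum (λ i → ℤ.+ f i) ≡ ℤ.+ sum f
  sum-pos {zero}  f = refl
  sum-pos {suc n} f = trans (cong (ℤ._+_ (ℤ.+ f zero)) (sum-pos (f ∘ suc))) (sym (ℤ.pos-+ (f zero) _))

  sum-neg : ∀ {n} (f : Fin n → ℤ) → Σℤ.sum (λ i → ℤ.- f i) ≡ ℤ.- Σℤ.sum f
  sum-neg {zero}  f = refl
  sum-neg {suc n} f = trans (cong (ℤ._+_ (ℤ.- f zero)) (sum-neg (f ∘ suc))) (sym (ℤ.neg-distrib-+ (f zero) _))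

  [_] : ∀ {p} {P : Set p} → Dec P → ℕ
  [ P? ] = if does P? then 1 else 0

  []≤1 : ∀ {p} {P : Set p} (P? : Dec P) → [ P? ] ≤ 1
  []≤1 (yes _) = ≤-refl
  []≤1 (no _)  = z≤n

  [yes]≡1 : ∀ {p} {P : Set p} (P? : Dec P) → P → [ P? ] ≡ 1
  [yes]≡1 P? p = cong (if_then 1 else 0) (dec-true P? p)

  [no]≡0 : ∀ {p} {P : Set p} (P? : Dec P) → ¬ P → [ P? ] ≡ 0
  [no]≡0 P? ¬p = cong (if_then 1 else 0) (dec-false P? ¬p)

  sum-[]≤1 : ∀ {n p} {P : Fin n → Set p} (P? : ∀ i → Dec (P i)) →
             (∀ {i j} → P i → P j → i ≡ j) → sum (λ i → [ P? i ]) ≤ 1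
  sum-[]≤1 P? unique with Fin.any? P?
  ... | yes (i , p) = ≤-trans
          (≤-reflexive (Σℕ.sum-single i λ j j≢i → [no]≡0 (P? j) λ q → j≢i (unique q p)))
          ([]≤1 (P? i))
  ... | no ¬p = ≤-trans (≤-reflexive (Σℕ.sum-zero λ i → [no]≡0 (P? i) λ p → ¬p (i , p))) z≤n

  1≤sum-[] : ∀ {n p} {P : Fin n → Set p} (P? : ∀ i → Dec (P i)) {i} → P i → 1 ≤ sum (λ i → [ P? i ])
  1≤sum-[] P? {i} p = subst (_≤ _) ([yes]≡1 (P? i) p) (lookup≤sum (λ i → [ P? i ]) i)

  -- The gap is (x - y)². Writing the larger number as the smaller plus `d` turns it into `d * d`
  -- and avoids truncated subtraction.
  4xy≤[x+y]² : ∀ x y → 4 * (x * y) ≤ (x + y) * (x + y)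
  4xy≤[x+y]² x y with ≤-total x y
  ... | inj₁ x≤y = subst (λ y → 4 * (x * y) ≤ (x + y) * (x + y)) (m+[n∸m]≡n x≤y) (go x (y ∸ x))
    where
    go : ∀ x d → 4 * (x * (x + d)) ≤ (x + (x + d)) * (x + (x + d))
    go x d = subst (4 * (x * (x + d)) ≤_) (eq x d) (m≤m+n _ (d * d))
      where
      eq : ∀ x d → 4 * (x * (x + d)) + d * d ≡ (x + (x + d)) * (x + (x + d))
      eq = solve-∀
  ... | inj₂ y≤x = subst (λ x → 4 * (x * y) ≤ (x + y) * (x + y)) (m+[n∸m]≡n y≤x) (go y (x ∸ y))
    where
    go : ∀ y d → 4 * ((y + d) * y) ≤ (y + d + y) * (y + d + y)
    go y d = subst (4 * ((y + d) * y) ≤_) (eq y d) (m≤m+n _ (d * d))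
      where
      eq : ∀ y d → 4 * ((y + d) * y) + d * d ≡ (y + d + y) * (y + d + y)
      eq = solve-∀

  -- ℕ._≟_ made opaque: does (m ℕ.≟ n) computes to m ≡ᵇ n, where a with-abstraction of m ℕ.≟ n misses it.
  opaque
    _≟ℕ_ : (m n : ℕ) → Dec (m ≡ n)
    _≟ℕ_ = ℕ._≟_

  -- The Möbius recursion.

  module MöbiusProperties {N : ℕ} {a b} {_≈_ : Rel (Fin N) a} {_≼_ : Rel (Fin N) b}
    (isDecPartialOrder : IsDecPartialOrder _≈_ _≼_) where

    open IsDecPartialOrder isDecPartialOrder
      using (isPartialOrder; _≟_; _≤?_; module Eq)
    open ToStrict _≈_ _≼_ using () renaming (_<_ to _≺_)
    open Möbius isDecPartialOrder renaming (μ to möbius)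

    -- The summand of `μ-acc` is local to its definition and cannot be named; the existential lets
    -- unification capture it, and its first projection then stands for it.
    μ-acc-unfold : ∀ x y (below : ∀ {z} → z ≺ y → Acc _≺_ z) → ∃ λ (term : Fin N → ℤ) →
      μ-acc x y (acc below) ≡ (if does (x ≟ y) then 1ℤ else ℤ.- Σℤ.sum term)
    μ-acc-unfold x y below = _ , refl

    -- The recursion reaches z with the accessibility proof inherited from y, whereas `möbius x z`
    -- uses its own; this identifies the two values.
    μ-acc-irrelevant : ∀ x y p q → μ-acc x y p ≡ μ-acc x y q
    μ-acc-irrelevant x y (acc p) (acc q) =
      cong (λ s → if does (x ≟ y) then 1ℤ else ℤ.- s) (Σℤ.sum-cong-≗ terms)
      where
      terms : ∀ z → proj₁ (μ-acc-unfold x y p) z ≡ proj₁ (μ-acc-unfold x y q) z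
      terms z with x ≤? z | z <? y
      ... | yes _ | yes z<y = μ-acc-irrelevant x z (p z<y) (q z<y)
      ... | yes _ | no _    = refl
      ... | no _  | _       = refl

    μ-refl : ∀ x → möbius x x ≡ 1ℤ
    μ-refl x with po-wellFounded isPartialOrder x
    ... | acc below = cong (λ b → if b then 1ℤ else ℤ.- Σℤ.sum (proj₁ (μ-acc-unfold x x below)))
                        (dec-true (x ≟ x) Eq.refl)

    μ-rec : ∀ {x y} → ¬ x ≈ y →
            möbius x y ≡ ℤ.- Σℤ.sum λ z → if does (x ≤? z ×-dec z <? y) then möbius x z else 0ℤ
    μ-rec {x} {y} x≉y with po-wellFounded isPartialOrder y
    ... | acc below = trans
      (cong (λ b → if b then 1ℤ else ℤ.- Σℤ.sum (proj₁ (μ-acc-unfold x y below))) (dec-false (x ≟ y) x≉y))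
      (cong ℤ.-_ (Σℤ.sum-cong-≗ λ z → select z (x ≤? z ×-dec z <? y)))
      where
      inner : ∀ z → x ≼ z → z ≺ y → proj₁ (μ-acc-unfold x y below) z ≡ möbius x z
      inner z x≼z z≺y with x ≤? z | z <? y
      ... | yes _  | yes p  = μ-acc-irrelevant x z (below p) (po-wellFounded isPartialOrder z)
      ... | yes _  | no z⊀y = contradiction z≺y z⊀y
      ... | no x⋠z | _      = contradiction x≼z x⋠z

      outer : ∀ z → ¬ (x ≼ z × z ≺ y) → proj₁ (μ-acc-unfold x y below) z ≡ 0ℤ
      outer z ¬xzy with x ≤? z | z <? y
      ... | yes x≼z | yes z≺y = contradiction (x≼z , z≺y) ¬xzy
      ... | yes _   | no _    = refl
      ... | no _    | _       = refl

      select : ∀ z (xzy? : Dec (x ≼ z × z ≺ y)) →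
        proj₁ (μ-acc-unfold x y below) z ≡ (if does xzy? then möbius x z else 0ℤ)
      select z (yes (x≼z , z≺y)) = inner z x≼z z≺y
      select z (no ¬xzy)         = outer z ¬xzy

  -- Coefficients of the polynomial in an abstract lattice of flats.

  1-[1+n]≡-n : ∀ n → 1ℤ ℤ.+ ℤ.- (ℤ.+ suc n) ≡ ℤ.- (ℤ.+ n)
  1-[1+n]≡-n zero    = refl
  1-[1+n]≡-n (suc n) = refl

  -- A₀ + A₁ w + A₂ w² + A₃ w³ = (w + 1) (α w² + s w + c), the second factor being nonzero and of
  -- nonnegative discriminant.
  RealFactorisation : (ℕ → ℕ) → Set
  RealFactorisation A = ∃ λ α → ∃ λ s → ∃ λ c →
    A 0 ≡ c × A 1 ≡ s + c × A 2 ≡ α + s × A 3 ≡ α × 4 * (α * c) ≤ s * s × 1 ≤ α + s + c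

  -- What the counting needs from flats, free of linear algebra. `corank` is codimension, so it
  -- falls along the order; `≼∧corank≤⇒≡` carries the dimension arguments, and `hyperplane-meet`
  -- says that two hyperplanes always intersect in codimension 2.
  record HyperplaneLattice {N : ℕ} {a b} {_≈_ : Rel (Fin N) a} {_≼_ : Rel (Fin N) b}
    (isDecPartialOrder : IsDecPartialOrder _≈_ _≼_) : Set (a Level.⊔ b) where
    field
      ≈⇒≡       : ∀ {x y} → x ≈ y → x ≡ y
      corank     : Fin N → ℕ
      ⊥ ⊤       : Fin N
      ⊥-minimum : ∀ x → ⊥ ≼ x
      ⊤-maximum : ∀ x → x ≼ ⊤
      corank-⊤   : corank ⊤ ≡ 0
      ≼∧corank≤⇒≡ : ∀ {x y} → x ≼ y → corank x ≤ corank y → x ≡ y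
      hyperplane-above  : ∀ x → x ≢ ⊤ → ∃ λ h → corank h ≡ 1 × x ≼ h
      hyperplane-avoiding : ∀ x → x ≢ ⊥ → ∃ λ h → corank h ≡ 1 × ¬ x ≼ h
      hyperplane-meet : ∀ {h h′} → corank h ≡ 1 → corank h′ ≡ 1 → h ≢ h′ →
        ∃ λ m → corank m ≡ 2 × m ≼ h × m ≼ h′ × (∀ p → p ≼ h → p ≼ h′ → p ≼ m)

    open IsDecPartialOrder isDecPartialOrder public
      using () renaming (_≤?_ to _≼?_; refl to ≼-refl)
    open IsDecPartialOrder isDecPartialOrder using (_≟_; module Eq)
    open Möbius isDecPartialOrder using (_<?_) renaming (μ to möbius)
    open MöbiusProperties isDecPartialOrder

    g : Fin N → ℤ
    g = möbius ⊥

    corank-antitone : ∀ {x y} → x ≼ y → corank y ≤ corank x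
    corank-antitone {x} {y} x≼y with ≤-total (corank y) (corank x)
    ... | inj₁ le = le
    ... | inj₂ ge = ≤-reflexive (cong corank (sym (≼∧corank≤⇒≡ x≼y ge)))

    corank-strict : ∀ {x y} → x ≼ y → x ≢ y → corank y < corank x
    corank-strict x≼y x≢y = ≰⇒> λ le → x≢y (≼∧corank≤⇒≡ x≼y le)

    corank≤rank : ∀ x → corank x ≤ corank ⊥
    corank≤rank x = corank-antitone (⊥-minimum x)

    corank≡0⇒⊤ : ∀ {x} → corank x ≡ 0 → x ≡ ⊤
    corank≡0⇒⊤ {x} eq = ≼∧corank≤⇒≡ (⊤-maximum x) (≤-trans (≤-reflexive eq) z≤n)

    corank≡rank⇒⊥ : ∀ {x} → corank x ≡ corank ⊥ → x ≡ ⊥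
    corank≡rank⇒⊥ {x} eq = sym (≼∧corank≤⇒≡ (⊥-minimum x) (≤-reflexive (sym eq)))

    -- Summand over the open interval from `⊥` to `y`: the recursion with its term μ(⊥,⊥) = 1 split
    -- off.
    between : Fin N → Fin N → ℤ
    between y z = if does (z Fin.≟ ⊥) then 0ℤ else if does (z Fin.≟ y) then 0ℤ else
                  if does (z ≼? y) then g z else 0ℤ

    g-⊥ : g ⊥ ≡ 1ℤ
    g-⊥ = μ-refl ⊥

    g-rec : ∀ {y} → y ≢ ⊥ → g y ≡ ℤ.- (1ℤ ℤ.+ Σℤ.sum (between y))
    g-rec {y} y≢⊥ = trans (μ-rec λ ⊥≈y → y≢⊥ (sym (≈⇒≡ ⊥≈y))) (cong ℤ.-_ (begin
      Σℤ.sum (λ z → if does (⊥ ≼? z ×-dec z <? y) then g z else 0ℤ)  ≡⟨ Σℤ.sum-cong-≗ terms ⟩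
      Σℤ.sum (λ z → at⊥ z ℤ.+ between y z)      ≡⟨ Σℤ.∑-distrib-+ at⊥ (between y) ⟩
      Σℤ.sum at⊥ ℤ.+ Σℤ.sum (between y)         ≡⟨ cong (ℤ._+ Σℤ.sum (between y)) (trans (Σℤ.sum-single ⊥ off) on) ⟩
      1ℤ ℤ.+ Σℤ.sum (between y)                 ∎))
      where
      open ≡-Reasoning
      at⊥ : Fin N → ℤ
      at⊥ z = if does (z Fin.≟ ⊥) then 1ℤ else 0ℤ

      on : at⊥ ⊥ ≡ 1ℤ
      on = cong (if_then 1ℤ else 0ℤ) (dec-true (⊥ Fin.≟ ⊥) refl)

      off : ∀ z → z ≢ ⊥ → at⊥ z ≡ 0ℤ
      off z z≢⊥ = cong (if_then 1ℤ else 0ℤ) (dec-false (z Fin.≟ ⊥) z≢⊥)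

      terms : ∀ z → (if does (⊥ ≼? z ×-dec z <? y) then g z else 0ℤ) ≡ at⊥ z ℤ.+ between y z
      terms z with ⊥ ≼? z | z Fin.≟ ⊥
      ... | no ⊥⋠z | _ = contradiction (⊥-minimum z) ⊥⋠z
      ... | yes _ | yes refl with ⊥ ≼? y | ⊥ ≟ y
      ...   | yes _  | no _    = g-⊥
      ...   | yes _  | yes ⊥≈y = contradiction (sym (≈⇒≡ ⊥≈y)) y≢⊥
      ...   | no ⊥⋠y | _       = contradiction (⊥-minimum y) ⊥⋠y
      terms z | yes _ | no _ with z ≼? y | z ≟ y | z Fin.≟ y
      ... | yes _   | yes _   | yes _    = refl
      ... | yes _   | yes z≈y | no z≢y   = contradiction (≈⇒≡ z≈y) z≢y
      ... | yes _   | no z≉y  | yes refl = contradiction Eq.refl z≉y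
      ... | yes _   | no _    | no _     = sym (ℤ.+-identityˡ _)
      ... | no _    | _       | yes _    = refl
      ... | no _    | _       | no _     = refl

    ∣g∣ : ∀ {y n} → y ≢ ⊥ → Σℤ.sum (between y) ≡ n → ℤ.∣ g y ∣ ≡ ℤ.∣ 1ℤ ℤ.+ n ∣
    ∣g∣ {y} y≢⊥ refl = trans (cong ℤ.∣_∣ (g-rec y≢⊥)) (ℤ.∣-i∣≡∣i∣ (1ℤ ℤ.+ Σℤ.sum (between y)))

    -- Serves to evaluate an interval sum by a formula `t`. As `t` is summed over all flats, it has
    -- to vanish at both ends and outside the interval.
    between-cong : ∀ y (t : Fin N → ℤ) → t ⊥ ≡ 0ℤ → (y ≢ ⊥ → t y ≡ 0ℤ) →
      (∀ z → z ≢ ⊥ → z ≢ y → z ≼ y → g z ≡ t z) → (∀ z → ¬ z ≼ y → t z ≡ 0ℤ) →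
      Σℤ.sum (between y) ≡ Σℤ.sum t
    between-cong y t t⊥ ty inner outer = Σℤ.sum-cong-≗ terms
      where
      terms : ∀ z → between y z ≡ t z
      terms z with z Fin.≟ ⊥
      ... | yes refl = sym t⊥
      ... | no z≢⊥ with z Fin.≟ y
      ...   | yes refl = sym (ty z≢⊥)
      ...   | no z≢y with z ≼? y
      ...     | yes z≼y = inner z z≢⊥ z≢y z≼y
      ...     | no z⋠y  = sym (outer z z⋠y)

    -- Coranks change strictly along the order and none lies strictly between those of `y` and `⊥`,
    -- so the open interval is empty.
    g-atom : ∀ {y} → suc (corank y) ≡ corank ⊥ → g y ≡ ℤ.-1ℤ
    g-atom {y} eq = trans (g-rec y≢⊥) (cong (λ n → ℤ.- (1ℤ ℤ.+ n)) (trans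
      (between-cong y (λ _ → 0ℤ) refl (λ _ → refl) empty λ _ _ → refl)
      (Σℤ.sum-zero {t = λ (_ : Fin N) → 0ℤ} λ _ → refl)))
      where
      y≢⊥ : y ≢ ⊥
      y≢⊥ refl = 1+n≢n eq
      empty : ∀ z → z ≢ ⊥ → z ≢ y → z ≼ y → g z ≡ 0ℤ
      empty z z≢⊥ z≢y z≼y = contradiction
        (≤-trans (corank-strict (⊥-minimum z) (z≢⊥ ∘ sym)) (≤-reflexive (sym eq)))
        (<⇒≱ (s≤s (corank-strict z≼y z≢y)))

    -- The coefficient of (z − 1)ʲ in P.
    coefficient : ℕ → ℕ
    coefficient j = sum λ x → if does (corank x ≟ℕ j) then ℤ.∣ g x ∣ else 0

    coefficient-single : ∀ {j} x → corank x ≡ j → (∀ z → corank z ≡ j → z ≡ x) → coefficient j ≡ ℤ.∣ g x ∣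
    coefficient-single {j} x eq unique = trans
      (Σℕ.sum-single x λ z z≢x → cong (if_then ℤ.∣ g z ∣ else 0)
        (dec-false (corank z ≟ℕ j) λ e → z≢x (unique z e)))
      (cong (if_then ℤ.∣ g x ∣ else 0) (dec-true (corank x ≟ℕ j) eq))

    coefficient-rank : ∀ {r} → corank ⊥ ≡ r → coefficient r ≡ 1
    coefficient-rank refl = trans (coefficient-single ⊥ refl λ _ → corank≡rank⇒⊥) (cong ℤ.∣_∣ g-⊥)

    coefficient-0 : coefficient 0 ≡ ℤ.∣ g ⊤ ∣
    coefficient-0 = coefficient-single ⊤ corank-⊤ λ _ → corank≡0⇒⊤

    coefficient-large : ∀ {j} → corank ⊥ < j → coefficient j ≡ 0
    coefficient-large {j} r<j = Σℕ.sum-zero λ z → cong (if_then ℤ.∣ g z ∣ else 0)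
      (dec-false (corank z ≟ℕ j) λ { refl → <⇒≱ r<j (corank≤rank z) })

    count : ℕ → ℕ
    count j = sum λ x → [ corank x ≟ℕ j ]

    coefficient-atoms : ∀ {j} → suc j ≡ corank ⊥ → coefficient j ≡ count j
    coefficient-atoms {j} eq = Σℕ.sum-cong-≗ terms
      where
      terms : ∀ x → (if does (corank x ≟ℕ j) then ℤ.∣ g x ∣ else 0) ≡ [ corank x ≟ℕ j ]
      terms x with corank x ≟ℕ j
      ... | yes refl = cong ℤ.∣_∣ (g-atom eq)
      ... | no _     = refl

    rank≢0⇒⊤≢⊥ : ∀ {r} → corank ⊥ ≡ suc r → ⊤ ≢ ⊥
    rank≢0⇒⊤≢⊥ eq ⊤≡⊥ with trans (sym corank-⊤) (trans (cong corank ⊤≡⊥) eq)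
    ... | ()

    1≤count-1 : ∀ {r} → corank ⊥ ≡ suc r → 1 ≤ count 1
    1≤count-1 eq =
      let h , corank-h , _ = hyperplane-above ⊥ (rank≢0⇒⊤≢⊥ eq ∘ sym)
      in 1≤sum-[] (λ x → corank x ≟ℕ 1) corank-h

    proper-corank : ∀ {z} → z ≢ ⊥ → z ≢ ⊤ → 1 ≤ corank z × corank z < corank ⊥
    proper-corank {z} z≢⊥ z≢⊤ =
      n≢0⇒n>0 (z≢⊤ ∘ corank≡0⇒⊤) , corank-strict (⊥-minimum z) (z≢⊥ ∘ sym)

    rank-1 : corank ⊥ ≡ 1 → RealFactorisation coefficient
    rank-1 r≡1 = 0 , 0 , 1
      , trans coefficient-0 (∣g∣ ⊤≢⊥ (trans
          (between-cong ⊤ (λ _ → 0ℤ) refl (λ _ → refl) empty λ _ _ → refl)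
          (Σℤ.sum-zero {t = λ (_ : Fin N) → 0ℤ} λ _ → refl)))
      , coefficient-rank r≡1
      , coefficient-large (≤-reflexive (cong suc r≡1))
      , coefficient-large (s≤s (≤-trans (≤-reflexive r≡1) (n≤1+n 1)))
      , z≤n , ≤-refl
      where
      ⊤≢⊥ : ⊤ ≢ ⊥
      ⊤≢⊥ = rank≢0⇒⊤≢⊥ r≡1
      empty : ∀ z → z ≢ ⊥ → z ≢ ⊤ → z ≼ ⊤ → g z ≡ 0ℤ
      empty z z≢⊥ z≢⊤ _ =
        let 1≤corank , corank<r = proper-corank z≢⊥ z≢⊤
        in contradiction 1≤corank (<⇒≱ (subst (corank z <_) r≡1 corank<r))

    rank-2 : corank ⊥ ≡ 2 → RealFactorisation coefficient
    rank-2 r≡2 with count 1 in count≡ | 1≤count-1 r≡2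
    -- Here `h` is one less than the number of hyperplanes, so the second factor is w + `h`.
    ... | suc h | _ = 0 , 1 , h
      , trans coefficient-0 (trans (∣g∣ (rank≢0⇒⊤≢⊥ r≡2) hyperplanes)
          (trans (cong ℤ.∣_∣ (1-[1+n]≡-n h)) (ℤ.∣-i∣≡∣i∣ (ℤ.+ h))))
      , trans (coefficient-atoms (sym r≡2)) count≡
      , coefficient-rank r≡2
      , coefficient-large (s≤s (≤-reflexive r≡2))
      , z≤n , s≤s z≤n
      where
      t : Fin N → ℤ
      t z = ℤ.- (ℤ.+ [ corank z ≟ℕ 1 ])

      t-no : ∀ {z r} → corank z ≡ r → r ≢ 1 → t z ≡ 0ℤ
      t-no {z} refl ≢1 = cong (λ n → ℤ.- (ℤ.+ n)) ([no]≡0 (corank z ≟ℕ 1) ≢1)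

      inner : ∀ z → z ≢ ⊥ → z ≢ ⊤ → z ≼ ⊤ → g z ≡ t z
      inner z z≢⊥ z≢⊤ _ =
        let 1≤corank , corank<r = proper-corank z≢⊥ z≢⊤
            corank≡1 = ≤-antisym (s≤s⁻¹ (subst (corank z <_) r≡2 corank<r)) 1≤corank
        in trans (g-atom (trans (cong suc corank≡1) (sym r≡2)))
                 (cong (λ n → ℤ.- (ℤ.+ n)) (sym ([yes]≡1 (corank z ≟ℕ 1) corank≡1)))

      hyperplanes : Σℤ.sum (between ⊤) ≡ ℤ.- (ℤ.+ suc h)
      hyperplanes = trans
        (between-cong ⊤ t (t-no r≡2 λ ()) (λ _ → t-no corank-⊤ λ ()) inner
          λ z z⋠⊤ → contradiction (⊤-maximum z) z⋠⊤)
        (trans (sum-neg λ z → ℤ.+ [ corank z ≟ℕ 1 ])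
          (cong ℤ.-_ (trans (sum-pos λ z → [ corank z ≟ℕ 1 ]) (cong ℤ.+_ count≡))))

    -- Incidences of points and hyperplanes in rank 3.

    module Rank3 (r≡3 : corank ⊥ ≡ 3) where

      H : Fin N
      H = proj₁ (hyperplane-above ⊥ (rank≢0⇒⊤≢⊥ r≡3 ∘ sym))

      corank-H : corank H ≡ 1
      corank-H = proj₁ (proj₂ (hyperplane-above ⊥ (rank≢0⇒⊤≢⊥ r≡3 ∘ sym)))

      point hyper : Fin N → ℕ
      point p = [ corank p ≟ℕ 2 ]
      hyper y = [ corank y ≟ℕ 1 ]

      off : Fin N → ℕ
      off p = [ ¬? (p ≼? H) ]

      points pointsOff degree : Fin N → ℕ
      points y    = sum λ p → point p * [ p ≼? y ]
      pointsOff y = sum λ p → point p * [ p ≼? y ] * off p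
      degree p    = sum λ y → hyper y * [ p ≼? y ]

      k q M : ℕ
      k = points H
      q = sum λ p → point p * off p
      M = sum λ y → hyper y * pointsOff y

      -- A point on both `y` and `H` lies below their meet `m`, and equal coranks force it to be
      -- `m`; the successor accounts for that single point.
      points-split : ∀ {y} → corank y ≡ 1 → y ≢ H → points y ≡ suc (pointsOff y)
      points-split {y} corank-y y≢H = trans (Σℕ.sum-cong-≗ terms)
        (trans (Σℕ.∑-distrib-+ (λ p → [ p Fin.≟ m ]) (λ p → point p * [ p ≼? y ] * off p))
          (cong (_+ pointsOff y) (trans
            (Σℕ.sum-single m λ p p≢m → [no]≡0 (p Fin.≟ m) p≢m) ([yes]≡1 (m Fin.≟ m) refl))))
        where
        meet : _
        meet = hyperplane-meet corank-y corank-H y≢H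
        m : Fin N
        m = proj₁ meet
        corank-m : corank m ≡ 2
        corank-m = proj₁ (proj₂ meet)
        m≼y : m ≼ y
        m≼y = proj₁ (proj₂ (proj₂ meet))
        m≼H : m ≼ H
        m≼H = proj₁ (proj₂ (proj₂ (proj₂ meet)))
        greatest : ∀ p → p ≼ y → p ≼ H → p ≼ m
        greatest = proj₂ (proj₂ (proj₂ (proj₂ meet)))
        terms : ∀ p → point p * [ p ≼? y ] ≡ [ p Fin.≟ m ] + point p * [ p ≼? y ] * off p
        terms p with corank p ≟ℕ 2 | p ≼? y | p ≼? H | p Fin.≟ m
        ... | yes _ | yes _   | yes _   | yes _ = refl
        ... | yes e | yes p≼y | yes p≼H | no p≢m = contradiction
                (≼∧corank≤⇒≡ (greatest p p≼y p≼H) (≤-reflexive (trans e (sym corank-m)))) p≢m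
        ... | yes _ | yes _   | no p⋠H  | yes refl = contradiction m≼H p⋠H
        ... | yes _ | yes _   | no _    | no _ = refl
        ... | yes _ | no p⋠y  | _       | yes refl = contradiction m≼y p⋠y
        ... | yes _ | no _    | _       | no _ = refl
        ... | no e  | _       | _       | yes refl = contradiction corank-m e
        ... | no _  | _       | _       | no _ = refl

      pointsOff-H : pointsOff H ≡ 0
      pointsOff-H = Σℕ.sum-zero terms
        where
        terms : ∀ p → point p * [ p ≼? H ] * off p ≡ 0
        terms p with p ≼? H
        ... | yes _ = *-zeroʳ (point p * 1)
        ... | no _  = cong (_* 1) (*-zeroʳ (point p))

      -- In rank 3 a hyperplane is not `⊥`, so some hyperplane fails to contain `H`; the two are
      -- distinct and their meet is a point on `H`.
      1≤k : 1 ≤ k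
      1≤k =
        let h , corank-h , H⋠h = hyperplane-avoiding H H≢⊥
            m , corank-m , _ , m≼H , _ = hyperplane-meet corank-h corank-H λ h≡H → H⋠h (subst (H ≼_) (sym h≡H) ≼-refl)
        in subst (_≤ k) (cong₂ _*_ ([yes]≡1 (corank m ≟ℕ 2) corank-m) ([yes]≡1 (m ≼? H) m≼H))
             (lookup≤sum (λ p → point p * [ p ≼? H ]) m)
        where
        H≢⊥ : H ≢ ⊥
        H≢⊥ H≡⊥ with trans (sym corank-H) (trans (cong corank H≡⊥) r≡3)
        ... | ()

      -- Strictly below `y` lie only `⊥`, contributing 1, and the points on `y`, contributing -1
      -- each. Counting the points as `suc n` keeps the result a natural number.
      g-hyper : ∀ {y n} → corank y ≡ 1 → points y ≡ suc n → g y ≡ ℤ.+ n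
      g-hyper {y} {n} corank-y points≡ = trans (g-rec y≢⊥) (begin
        ℤ.- (1ℤ ℤ.+ Σℤ.sum (between y))      ≡⟨ cong (λ i → ℤ.- (1ℤ ℤ.+ i)) (between-cong y t t⊥ (λ _ → ty) inner outer) ⟩
        ℤ.- (1ℤ ℤ.+ Σℤ.sum t)                ≡⟨ cong (λ i → ℤ.- (1ℤ ℤ.+ i)) (sum-neg λ p → ℤ.+ (point p * [ p ≼? y ])) ⟩
        ℤ.- (1ℤ ℤ.+ ℤ.- Σℤ.sum (λ p → ℤ.+ (point p * [ p ≼? y ])))
                                             ≡⟨ cong (λ i → ℤ.- (1ℤ ℤ.+ ℤ.- i)) (trans (sum-pos λ p → point p * [ p ≼? y ]) (cong ℤ.+_ points≡)) ⟩
        ℤ.- (1ℤ ℤ.+ ℤ.- (ℤ.+ suc n))         ≡⟨ cong ℤ.-_ (1-[1+n]≡-n n) ⟩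
        ℤ.- (ℤ.- (ℤ.+ n))                    ≡⟨ ℤ.neg-involutive (ℤ.+ n) ⟩
        ℤ.+ n                                ∎)
        where
        open ≡-Reasoning
        t : Fin N → ℤ
        t p = ℤ.- (ℤ.+ (point p * [ p ≼? y ]))
        y≢⊥ : y ≢ ⊥
        y≢⊥ y≡⊥ with trans (sym corank-y) (trans (cong corank y≡⊥) r≡3)
        ... | ()
        t-no : ∀ {p r} → corank p ≡ r → r ≢ 2 → t p ≡ 0ℤ
        t-no {p} refl ≢2 = cong (λ n → ℤ.- (ℤ.+ (n * [ p ≼? y ]))) ([no]≡0 (corank p ≟ℕ 2) ≢2)
        t⊥ : t ⊥ ≡ 0ℤ
        t⊥ = t-no r≡3 λ ()
        ty : t y ≡ 0ℤ
        ty = t-no corank-y λ ()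
        outer : ∀ z → ¬ z ≼ y → t z ≡ 0ℤ
        outer z z⋠y = cong (λ n → ℤ.- (ℤ.+ n)) (trans (cong (point z *_) ([no]≡0 (z ≼? y) z⋠y)) (*-zeroʳ (point z)))
        inner : ∀ z → z ≢ ⊥ → z ≢ y → z ≼ y → g z ≡ t z
        inner z z≢⊥ z≢y z≼y = trans (g-atom (trans (cong suc corank≡2) (sym r≡3)))
          (cong (λ n → ℤ.- (ℤ.+ n)) (sym (cong₂ _*_ ([yes]≡1 (corank z ≟ℕ 2) corank≡2) ([yes]≡1 (z ≼? y) z≼y))))
          where
          corank≡2 : corank z ≡ 2
          corank≡2 = ≤-antisym
            (s≤s⁻¹ (subst (corank z <_) r≡3 (corank-strict (⊥-minimum z) (z≢⊥ ∘ sym))))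
            (subst (_< corank z) corank-y (corank-strict z≼y z≢y))

      -- Reconciles the signed values in the recursion at `⊤` with the absolute values in
      -- `coefficient 1`. Both cases rest on `y` containing a point.
      g-hyper-pos : ∀ {y} → corank y ≡ 1 → g y ≡ ℤ.+ ℤ.∣ g y ∣
      g-hyper-pos {y} corank-y with y Fin.≟ H
      ... | no y≢H = let eq = g-hyper corank-y (points-split corank-y y≢H) in
              trans eq (cong ℤ.+_ (sym (cong ℤ.∣_∣ eq)))
      ... | yes refl with k in k≡ | 1≤k
      ...   | suc _ | _ = let eq = g-hyper corank-H k≡ in trans eq (cong ℤ.+_ (sym (cong ℤ.∣_∣ eq)))

      -- A hyperplane other than `H` contributes its points off `H`, while `H` contributes k - 1 and
      -- nothing to `M`; the added 1 completes the term of `H` to `k`.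
      coefficient-1 : coefficient 1 + 1 ≡ k + M
      coefficient-1 = begin
        coefficient 1 + 1              ≡⟨ cong (coefficient 1 +_) (trans (Σℕ.sum-single H λ y y≢H → [no]≡0 (y Fin.≟ H) y≢H) ([yes]≡1 (H Fin.≟ H) refl)) ⟨
        coefficient 1 + sum atH        ≡⟨ Σℕ.∑-distrib-+ c₁ atH ⟨
        sum (λ y → c₁ y + atH y)       ≡⟨ Σℕ.sum-cong-≗ terms ⟩
        sum (λ y → atH y * k + hyper y * pointsOff y) ≡⟨ Σℕ.∑-distrib-+ (λ y → atH y * k) (λ y → hyper y * pointsOff y) ⟩
        sum (λ y → atH y * k) + M      ≡⟨ cong (_+ M) (trans (Σℕ.sum-single H λ y y≢H → cong (_* k) ([no]≡0 (y Fin.≟ H) y≢H)) (trans (cong (_* k) ([yes]≡1 (H Fin.≟ H) refl)) (*-identityˡ k))) ⟩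
        k + M                          ∎
        where
        open ≡-Reasoning
        c₁ atH : Fin N → ℕ
        c₁ y = if does (corank y ≟ℕ 1) then ℤ.∣ g y ∣ else 0
        atH y = [ y Fin.≟ H ]
        gH+1 : ℤ.∣ g H ∣ + 1 ≡ k
        gH+1 with k in k≡ | 1≤k
        ... | suc n | _ = trans (cong (λ i → ℤ.∣ i ∣ + 1) (g-hyper corank-H k≡)) (+-comm n 1)
        terms : ∀ y → c₁ y + atH y ≡ atH y * k + hyper y * pointsOff y
        terms y with corank y ≟ℕ 1 | y Fin.≟ H
        ... | yes _ | yes refl = trans gH+1 (sym (trans (cong (λ n → 1 * k + 1 * n) pointsOff-H) (trans (+-identityʳ (1 * k)) (*-identityˡ k))))
        ... | yes e | no y≢H = trans (+-identityʳ _) (trans (cong ℤ.∣_∣ (g-hyper e (points-split e y≢H))) (sym (*-identityˡ _)))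
        ... | no e  | yes refl = contradiction corank-H e
        ... | no _  | no _ = refl

      count-2 : count 2 ≡ k + q
      count-2 = trans (Σℕ.sum-cong-≗ terms) (Σℕ.∑-distrib-+ (λ p → point p * [ p ≼? H ]) (λ p → point p * off p))
        where
        terms : ∀ p → point p ≡ point p * [ p ≼? H ] + point p * off p
        terms p with corank p ≟ℕ 2 | p ≼? H
        ... | yes _ | yes _ = refl
        ... | yes _ | no _  = refl
        ... | no _  | _     = refl

      -- Double counting: `M` collects the incidences by hyperplane, the right side by point.
      M≡ : M ≡ sum λ p → point p * off p * degree p
      M≡ = begin
        sum (λ y → hyper y * pointsOff y)     ≡⟨ Σℕ.sum-cong-≗ (λ y → *-distribˡ-sum (hyper y) λ p → point p * [ p ≼? y ] * off p) ⟩
        sum (λ y → sum λ p → hyper y * (point p * [ p ≼? y ] * off p)) ≡⟨ Σℕ.∑-comm (λ y p → hyper y * (point p * [ p ≼? y ] * off p)) ⟩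
        sum (λ p → sum λ y → hyper y * (point p * [ p ≼? y ] * off p)) ≡⟨ Σℕ.sum-cong-≗ (λ p → Σℕ.sum-cong-≗ λ y → rearrange (hyper y) (point p) [ p ≼? y ] (off p)) ⟩
        sum (λ p → sum λ y → point p * off p * (hyper y * [ p ≼? y ])) ≡⟨ Σℕ.sum-cong-≗ (λ p → *-distribˡ-sum (point p * off p) λ y → hyper y * [ p ≼? y ]) ⟨
        sum (λ p → point p * off p * degree p) ∎
        where
        open ≡-Reasoning
        rearrange : ∀ h p l o → h * (p * l * o) ≡ p * o * (h * l)
        rearrange = solve-∀

      1≤degree : ∀ p → corank p ≡ 2 → 1 ≤ degree p
      1≤degree p corank-p =
        let h , corank-h , p≼h = hyperplane-above p p≢⊤
        in subst (_≤ degree p) (cong₂ _*_ ([yes]≡1 (corank h ≟ℕ 1) corank-h) ([yes]≡1 (p ≼? h) p≼h))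
             (lookup≤sum (λ y → hyper y * [ p ≼? y ]) h)
        where
        p≢⊤ : p ≢ ⊤
        p≢⊤ refl with trans (sym corank-p) corank-⊤
        ... | ()

      -- Distinct hyperplanes through p meet H in distinct points.
      degree≤k : ∀ p → corank p ≡ 2 → ¬ p ≼ H → degree p ≤ k
      degree≤k p corank-p p⋠H = begin
        -- Count pairs of a hyperplane through `p` and a point of `H` on it: each hyperplane occurs
        -- at least once, each point of `H` at most once.
        degree p                                                          ≤⟨ sum-mono-≤ meets-H ⟩
        sum (λ y → sum λ x → point x * [ x ≼? H ] * [ Joins? x y ])         ≡⟨ Σℕ.∑-comm (λ y x → point x * [ x ≼? H ] * [ Joins? x y ]) ⟩
        sum (λ x → sum λ y → point x * [ x ≼? H ] * [ Joins? x y ])         ≡⟨ Σℕ.sum-cong-≗ (λ x → *-distribˡ-sum (point x * [ x ≼? H ]) λ y → [ Joins? x y ]) ⟨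
        sum (λ x → point x * [ x ≼? H ] * sum λ y → [ Joins? x y ])         ≤⟨ sum-mono-≤ one-join ⟩
        k                                                                 ∎
        where
        open ≤-Reasoning

        Joins? : ∀ x y → Dec ((corank y ≡ 1 × p ≼ y) × x ≼ y)
        Joins? x y = (corank y ≟ℕ 1 ×-dec p ≼? y) ×-dec x ≼? y

        meets-H : ∀ y → hyper y * [ p ≼? y ] ≤ sum λ x → point x * [ x ≼? H ] * [ Joins? x y ]
        meets-H y = helper (corank y ≟ℕ 1) (p ≼? y)
          where
          helper : (y? : Dec (corank y ≡ 1)) (p≼y? : Dec (p ≼ y)) →
                   [ y? ] * [ p≼y? ] ≤ sum λ x → point x * [ x ≼? H ] * [ Joins? x y ]
          helper (no _) _ = z≤n
          helper (yes _) (no _) = z≤n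
          helper (yes corank-y) (yes p≼y) =
            let m , corank-m , m≼y , m≼H , _ = hyperplane-meet corank-y corank-H λ { refl → p⋠H p≼y }
            in subst (_≤ sum λ x → point x * [ x ≼? H ] * [ Joins? x y ])
                 (cong₂ _*_ (cong₂ _*_ ([yes]≡1 (corank m ≟ℕ 2) corank-m) ([yes]≡1 (m ≼? H) m≼H))
                            ([yes]≡1 (Joins? m y) ((corank-y , p≼y) , m≼y)))
                 (lookup≤sum (λ x → point x * [ x ≼? H ] * [ Joins? x y ]) m)

        unique : ∀ {x} → corank x ≡ 2 → x ≼ H → ∀ {y y′} →
                 (corank y ≡ 1 × p ≼ y) × x ≼ y → (corank y′ ≡ 1 × p ≼ y′) × x ≼ y′ → y ≡ y′
        unique {x} corank-x x≼H {y} {y′} ((e , p≼y) , x≼y) ((e′ , p≼y′) , x≼y′) with y Fin.≟ y′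
        ... | yes y≡y′ = y≡y′
        -- Two different hyperplanes share only one point, so `p` and `x` would coincide and `p`
        -- would lie on `H`.
        ... | no y≢y′ =
          let m , corank-m , _ , _ , greatest = hyperplane-meet e e′ y≢y′
              is-m = λ z corank-z z≼y z≼y′ →
                ≼∧corank≤⇒≡ (greatest z z≼y z≼y′) (≤-reflexive (trans corank-z (sym corank-m)))
              p≡x = trans (is-m p corank-p p≼y p≼y′) (sym (is-m x corank-x x≼y x≼y′))
          in contradiction (subst (_≼ H) (sym p≡x) x≼H) p⋠H

        one-join : ∀ x → point x * [ x ≼? H ] * (sum λ y → [ Joins? x y ]) ≤ point x * [ x ≼? H ]
        one-join x with corank x ≟ℕ 2 | x ≼? H
        ... | no _ | _ = z≤n
        ... | yes _ | no _ = z≤n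
        ... | yes corank-x | yes x≼H = ≤-trans (≤-reflexive (*-identityˡ _)) (sum-[]≤1 (Joins? x) (unique corank-x x≼H))

      -- Each point lies on at least one hyperplane. This makes the truncated difference of `M` and
      -- `q` exact.
      q≤M : q ≤ M
      q≤M = subst (q ≤_) (sym M≡) (sum-mono-≤ terms)
        where
        terms : ∀ p → point p * off p ≤ point p * off p * degree p
        terms p with corank p ≟ℕ 2
        ... | no _ = z≤n
        ... | yes corank-p = m≤m*n (1 * off p) (degree p) ⦃ >-nonZero (1≤degree p corank-p) ⦄

      M≤q*k : M ≤ q * k
      M≤q*k = ≤-trans (≤-reflexive M≡) (≤-trans (sum-mono-≤ terms) (≤-reflexive (sym (*-distribʳ-sum k (λ p → point p * off p)))))
        where
        terms : ∀ p → point p * off p * degree p ≤ point p * off p * k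
        terms p with corank p ≟ℕ 2 | p ≼? H
        ... | no _         | _      = z≤n
        ... | yes _        | yes _  = z≤n
        ... | yes corank-p | no p⋠H = *-monoʳ-≤ 1 (degree≤k p corank-p p⋠H)

      -- Strictly between `⊥` and `⊤` there are only points, each of value -1, and hyperplanes,
      -- whose values are already nonnegative.
      between-⊤ : Σℤ.sum (between ⊤) ≡ ℤ.- (ℤ.+ count 2) ℤ.+ ℤ.+ coefficient 1
      between-⊤ = begin
        Σℤ.sum (between ⊤)          ≡⟨ between-cong ⊤ t t⊥ (λ _ → t⊤) inner (λ z z⋠⊤ → contradiction (⊤-maximum z) z⋠⊤) ⟩
        Σℤ.sum t                    ≡⟨ Σℤ.∑-distrib-+ (λ z → ℤ.- (ℤ.+ point z)) (λ z → ℤ.+ c₁ z) ⟩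
        Σℤ.sum (λ z → ℤ.- (ℤ.+ point z)) ℤ.+ Σℤ.sum (λ z → ℤ.+ c₁ z)
          ≡⟨ cong₂ ℤ._+_ (trans (sum-neg λ z → ℤ.+ point z) (cong ℤ.-_ (sum-pos point))) (sum-pos c₁) ⟩
        ℤ.- (ℤ.+ count 2) ℤ.+ ℤ.+ coefficient 1 ∎
        where
        open ≡-Reasoning
        c₁ : Fin N → ℕ
        c₁ y = if does (corank y ≟ℕ 1) then ℤ.∣ g y ∣ else 0
        t : Fin N → ℤ
        t z = ℤ.- (ℤ.+ point z) ℤ.+ ℤ.+ c₁ z
        t-no : ∀ {z r} → corank z ≡ r → r ≢ 2 → r ≢ 1 → t z ≡ 0ℤ
        t-no {z} refl ≢2 ≢1 with corank z ≟ℕ 2 | corank z ≟ℕ 1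
        ... | yes e | _     = contradiction e ≢2
        ... | no _  | yes e = contradiction e ≢1
        ... | no _  | no _  = refl
        t⊥ : t ⊥ ≡ 0ℤ
        t⊥ = t-no r≡3 (λ ()) (λ ())
        t⊤ : t ⊤ ≡ 0ℤ
        t⊤ = t-no corank-⊤ (λ ()) (λ ())
        inner : ∀ z → z ≢ ⊥ → z ≢ ⊤ → z ≼ ⊤ → g z ≡ t z
        inner z z≢⊥ z≢⊤ _ with corank z ≟ℕ 2 | corank z ≟ℕ 1
        ... | yes e₂ | yes e₁ = contradiction (trans (sym e₁) e₂) λ ()
        ... | yes e₂ | no _ = g-atom (trans (cong suc e₂) (sym r≡3))
        ... | no _ | yes e₁ = trans (g-hyper-pos e₁) (sym (ℤ.+-identityˡ _))
        ... | no ≢2 | no ≢1 =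
          let 1≤corank , corank<r = proper-corank z≢⊥ z≢⊤
          in contradiction
               (≤-antisym (s≤s⁻¹ (subst (corank z <_) r≡3 corank<r)) (≤∧≢⇒< 1≤corank (≢1 ∘ sym))) ≢2

    rank-3 : corank ⊥ ≡ 3 → RealFactorisation coefficient
    rank-3 r≡3 = 1 , s , c
      , trans coefficient-0 (trans (∣g∣ (rank≢0⇒⊤≢⊥ r≡3) between-⊤) (cong ℤ.∣_∣ last))
      , A₁
      , trans (coefficient-atoms (sym r≡3)) (trans count-2 (cong (_+ q) (sym 1+k′≡k)))
      , coefficient-rank r≡3
      , discriminant
      , s≤s z≤n
      where
      open Rank3 r≡3
      k′ s c : ℕ
      k′ = pred k
      s = k′ + q
      c = M ∸ q

      1+k′≡k : suc k′ ≡ k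
      1+k′≡k = suc-pred k ⦃ >-nonZero 1≤k ⦄

      A₁ : coefficient 1 ≡ s + c
      A₁ = suc-injective (begin
        suc (coefficient 1)    ≡⟨ +-comm 1 (coefficient 1) ⟩
        coefficient 1 + 1      ≡⟨ coefficient-1 ⟩
        k + M                  ≡⟨ cong₂ _+_ (sym 1+k′≡k) (sym (m+[n∸m]≡n q≤M)) ⟩
        suc k′ + (q + c)       ≡⟨ cong suc (+-assoc k′ q c) ⟨
        suc (s + c)            ∎)
        where open ≡-Reasoning

      -- The left side is -μ(⊥,⊤). With `suc s` points and `coefficient 1` equal to `s + c`,
      -- everything but `c` cancels.
      last : 1ℤ ℤ.+ (ℤ.- (ℤ.+ count 2) ℤ.+ ℤ.+ coefficient 1) ≡ ℤ.+ c
      last = begin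
        1ℤ ℤ.+ (ℤ.- (ℤ.+ count 2) ℤ.+ ℤ.+ coefficient 1)
          ≡⟨ cong₂ (λ m n → 1ℤ ℤ.+ (ℤ.- (ℤ.+ m) ℤ.+ ℤ.+ n)) (trans count-2 (cong (_+ q) (sym 1+k′≡k))) A₁ ⟩
        1ℤ ℤ.+ (ℤ.- (ℤ.+ suc s) ℤ.+ ℤ.+ (s + c))
          ≡⟨ ℤ.+-assoc 1ℤ (ℤ.- (ℤ.+ suc s)) (ℤ.+ (s + c)) ⟨
        1ℤ ℤ.+ ℤ.- (ℤ.+ suc s) ℤ.+ ℤ.+ (s + c)
          ≡⟨ cong₂ ℤ._+_ (1-[1+n]≡-n s) (ℤ.pos-+ s c) ⟩
        ℤ.- (ℤ.+ s) ℤ.+ (ℤ.+ s ℤ.+ ℤ.+ c)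
          ≡⟨ ℤ.+-assoc (ℤ.- (ℤ.+ s)) (ℤ.+ s) (ℤ.+ c) ⟨
        ℤ.- (ℤ.+ s) ℤ.+ ℤ.+ s ℤ.+ ℤ.+ c
          ≡⟨ cong (ℤ._+ ℤ.+ c) (ℤ.+-inverseˡ (ℤ.+ s)) ⟩
        0ℤ ℤ.+ ℤ.+ c
          ≡⟨ ℤ.+-identityˡ (ℤ.+ c) ⟩
        ℤ.+ c ∎
        where open ≡-Reasoning

      c≤k′q : c ≤ k′ * q
      c≤k′q = m≤n+o⇒m∸n≤o M q (≤-trans M≤q*k (≤-reflexive
        (trans (*-comm q k) (cong (_* q) (sym 1+k′≡k)))))

      discriminant : 4 * (1 * c) ≤ s * s
      discriminant = ≤-trans
        (*-monoʳ-≤ 4 (≤-trans (≤-reflexive (*-identityˡ c)) c≤k′q)) (4xy≤[x+y]² k′ q)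

    -- Rank 0 is excluded because its coefficients 1, 0, 0, 0 would need both c = 1 and s + c = 0
    -- with α = s = 0.
    coefficient-factorisation : corank ⊥ ≤ 3 → corank ⊥ ≢ 0 → RealFactorisation coefficient
    coefficient-factorisation r≤3 r≢0 with corank ⊥ in r≡ | r≤3
    ... | 0 | _ = contradiction refl r≢0
    ... | 1 | _ = rank-1 r≡
    ... | 2 | _ = rank-2 r≡
    ... | 3 | _ = rank-3 r≡
    ... | suc (suc (suc (suc _))) | s≤s (s≤s (s≤s ()))

-- Collecting the terms of a sum by exponent.

module GroupedSum {c ℓ} (M : CommutativeMonoid c ℓ) where
  open CommutativeMonoid M
  open Sum M using (sum; sum-cong-≋; ∑-distrib-+)
  open SumProperties M
  open Algebra.Properties.Monoid.Mult monoid using (×-homo-+; ×-cong) renaming (_×_ to _×ⁿ_)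
  open Relation.Binary.Reasoning.Setoid setoid

  weight : ∀ {n} → (Fin n → ℕ) → (Fin n → ℕ) → ℕ → ℕ
  weight m d j = Σℕ.sum λ i → if does (d i ≟ℕ j) then m i else 0

  -- Each term falls into exactly one of the `k` slots. Any strict bound `k` on the exponents is
  -- allowed, so that shorter polynomials can be padded with zero coefficients.
  group-by-degree : ∀ {n} k (m d : Fin n → ℕ) (t : ℕ → Carrier) → (∀ i → d i <ℕ k) →
    sum (λ i → m i ×ⁿ t (d i)) ≈ sum {k} (λ j → weight m d (toℕ j) ×ⁿ t (toℕ j))
  group-by-degree {zero}  k m d t d<k = sym (sum-zero {k} λ _ → refl)
  group-by-degree {suc n} k m d t d<k = begin
    m zero ×ⁿ t (d zero) ∙ sum (λ i → m (suc i) ×ⁿ t (d (suc i)))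
      ≈⟨ ∙-cong (sym head) (group-by-degree k (m ∘ suc) (d ∘ suc) t (d<k ∘ suc)) ⟩
    sum (λ j → first j ×ⁿ t (toℕ j)) ∙ sum (λ j → rest j ×ⁿ t (toℕ j))
      ≈⟨ ∑-distrib-+ (λ j → first j ×ⁿ t (toℕ j)) (λ j → rest j ×ⁿ t (toℕ j)) ⟨
    sum (λ j → first j ×ⁿ t (toℕ j) ∙ rest j ×ⁿ t (toℕ j))
      ≈⟨ sum-cong-≋ (λ j → ×-homo-+ (t (toℕ j)) (first j) (rest j)) ⟨
    sum {k} (λ j → weight m d (toℕ j) ×ⁿ t (toℕ j)) ∎
    where
    first rest : Fin k → ℕ
    first j = if does (d zero ≟ℕ toℕ j) then m zero else 0
    rest j  = weight (m ∘ suc) (d ∘ suc) (toℕ j)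
    j₀ : Fin k
    j₀ = fromℕ< (d<k zero)
    toℕ-j₀ : toℕ j₀ ≡ d zero
    toℕ-j₀ = Fin.toℕ-fromℕ< (d<k zero)
    head : sum (λ j → first j ×ⁿ t (toℕ j)) ≈ m zero ×ⁿ t (d zero)
    head = begin
      sum (λ j → first j ×ⁿ t (toℕ j)) ≈⟨ sum-single j₀ (λ j j≢j₀ → ×-cong
        (≡.cong (if_then m zero else 0) (dec-false (d zero ≟ℕ toℕ j)
          λ e → j≢j₀ (Fin.toℕ-injective (≡.sym (≡.trans toℕ-j₀ e))))) refl) ⟩
      first j₀ ×ⁿ t (toℕ j₀) ≈⟨ ×-cong
        (≡.cong (if_then m zero else 0) (dec-true (d zero ≟ℕ toℕ j₀) (≡.sym toℕ-j₀)))
        (reflexive (≡.cong t toℕ-j₀)) ⟩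
      m zero ×ⁿ t (d zero) ∎

-- The library's ring solver with coefficients in ℤ: only there are cancellations decidable by computation.
module IntegerSolver {c ℓ} (R : CommutativeRing c ℓ) where
  open CommutativeRing R hiding (zero)
  open Algebra.Properties.Semiring.Mult.TCOptimised semiring using (×-homo-+; ×1-homo-*; 1+×) renaming (_×_ to _×ⁿ_)
  open Algebra.Properties.Group +-group using (⁻¹-involutive; ε⁻¹≈ε)
  open Algebra.Properties.AbelianGroup +-abelianGroup using (⁻¹-∙-comm; xyx⁻¹≈y)
  open Algebra.Properties.Ring ring using (-‿distribˡ-*; -‿distribʳ-*)
  open Relation.Binary.Reasoning.Setoid setoid

  ⟦_⟧ℤ : ℤ → Carrier
  ⟦ ℤ.+ n ⟧ℤ      = n ×ⁿ 1#
  ⟦ ℤ.-[1+ n ] ⟧ℤ = - (suc n ×ⁿ 1#)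

  ⊖-homo : ∀ m n → ⟦ m ℤ.⊖ n ⟧ℤ ≈ m ×ⁿ 1# + - (n ×ⁿ 1#)
  ⊖-homo m       zero    = sym (trans (+-congˡ ε⁻¹≈ε) (+-identityʳ _))
  ⊖-homo zero    (suc n) = sym (+-identityˡ _)
  ⊖-homo (suc m) (suc n) = begin
    ⟦ suc m ℤ.⊖ suc n ⟧ℤ                  ≡⟨ ≡.cong ⟦_⟧ℤ (ℤ.[1+m]⊖[1+n]≡m⊖n m n) ⟩
    ⟦ m ℤ.⊖ n ⟧ℤ                          ≈⟨ ⊖-homo m n ⟩
    a + - b                               ≈⟨ +-congʳ (xyx⁻¹≈y 1# a) ⟨
    1# + a + - 1# + - b                   ≈⟨ +-assoc (1# + a) (- 1#) (- b) ⟩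
    1# + a + (- 1# + - b)                 ≈⟨ +-congˡ (⁻¹-∙-comm 1# b) ⟩
    1# + a + - (1# + b)                   ≈⟨ +-cong (1+× m 1#) (-‿cong (1+× n 1#)) ⟨
    suc m ×ⁿ 1# + - (suc n ×ⁿ 1#)         ∎
    where
    a b : Carrier
    a = m ×ⁿ 1#
    b = n ×ⁿ 1#

  +-homo : ∀ i j → ⟦ i ℤ.+ j ⟧ℤ ≈ ⟦ i ⟧ℤ + ⟦ j ⟧ℤ
  +-homo (ℤ.+ m)      (ℤ.+ n)      = ×-homo-+ 1# m n
  +-homo (ℤ.+ m)      ℤ.-[1+ n ]   = ⊖-homo m (suc n)
  +-homo ℤ.-[1+ m ]   (ℤ.+ n)      = trans (⊖-homo n (suc m)) (+-comm _ _)
  +-homo ℤ.-[1+ m ]   ℤ.-[1+ n ]   = trans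
    (-‿cong (trans (reflexive (≡.cong (λ k → suc k ×ⁿ 1#) (≡.sym (ℕ.+-suc m n)))) (×-homo-+ 1# (suc m) (suc n))))
    (sym (⁻¹-∙-comm _ _))

  -‿homo : ∀ i → ⟦ ℤ.- i ⟧ℤ ≈ - ⟦ i ⟧ℤ
  -‿homo (ℤ.+ zero)    = sym ε⁻¹≈ε
  -‿homo (ℤ.+ suc n)   = refl
  -‿homo ℤ.-[1+ n ]    = sym (⁻¹-involutive _)

  pos-*-homo : ∀ m j → ⟦ ℤ.+ m ℤ.* j ⟧ℤ ≈ ⟦ ℤ.+ m ⟧ℤ * ⟦ j ⟧ℤ
  pos-*-homo m (ℤ.+ n)    = trans (reflexive (≡.cong ⟦_⟧ℤ (≡.sym (ℤ.pos-* m n)))) (×1-homo-* m n)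
  pos-*-homo m ℤ.-[1+ n ] = begin
    ⟦ ℤ.+ m ℤ.* ℤ.-[1+ n ] ⟧ℤ              ≡⟨ ≡.cong ⟦_⟧ℤ (ℤ.neg-distribʳ-* (ℤ.+ m) (ℤ.+ suc n)) ⟨
    ⟦ ℤ.- (ℤ.+ m ℤ.* ℤ.+ suc n) ⟧ℤ         ≈⟨ -‿homo (ℤ.+ m ℤ.* ℤ.+ suc n) ⟩
    - ⟦ ℤ.+ m ℤ.* ℤ.+ suc n ⟧ℤ             ≈⟨ -‿cong (pos-*-homo m (ℤ.+ suc n)) ⟩
    - (⟦ ℤ.+ m ⟧ℤ * ⟦ ℤ.+ suc n ⟧ℤ)        ≈⟨ -‿distribʳ-* _ _ ⟩
    ⟦ ℤ.+ m ⟧ℤ * ⟦ ℤ.-[1+ n ] ⟧ℤ           ∎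

  *-homo : ∀ i j → ⟦ i ℤ.* j ⟧ℤ ≈ ⟦ i ⟧ℤ * ⟦ j ⟧ℤ
  *-homo (ℤ.+ m)    j = pos-*-homo m j
  *-homo ℤ.-[1+ m ] j = begin
    ⟦ ℤ.-[1+ m ] ℤ.* j ⟧ℤ              ≡⟨ ≡.cong ⟦_⟧ℤ (ℤ.neg-distribˡ-* (ℤ.+ suc m) j) ⟨
    ⟦ ℤ.- (ℤ.+ suc m ℤ.* j) ⟧ℤ         ≈⟨ -‿homo (ℤ.+ suc m ℤ.* j) ⟩
    - ⟦ ℤ.+ suc m ℤ.* j ⟧ℤ             ≈⟨ -‿cong (pos-*-homo (suc m) j) ⟩
    - (⟦ ℤ.+ suc m ⟧ℤ * ⟦ j ⟧ℤ)        ≈⟨ -‿distribˡ-* _ _ ⟩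
    ⟦ ℤ.-[1+ m ] ⟧ℤ * ⟦ j ⟧ℤ           ∎

  morphism : ℤ.+-*-rawRing -Raw-AlmostCommutative⟶ fromCommutativeRing R
  morphism = record
    { ⟦_⟧    = ⟦_⟧ℤ
    ; +-homo = +-homo
    ; *-homo = *-homo
    ; -‿homo = -‿homo
    ; 0-homo = refl
    ; 1-homo = refl
    }

  open Algebra.Solver.Ring ℤ.+-*-rawRing (fromCommutativeRing R) morphism
    (λ i j → Maybe.map (λ i≡j → reflexive (≡.cong ⟦_⟧ℤ i≡j)) (dec⇒maybe (i ℤ.≟ j)))
    public using (solve; con; _:+_; _:*_; _:-_; :-_; _:=_)

-- Ordered fields.

module OrderedFieldProperties {c ℓ₁ ℓ₂} (F : OrderedField c ℓ₁ ℓ₂) where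
  open OrderedField F hiding (zero)
  open IsStrictTotalOrder isStrictTotalOrder using (irrefl; <-respʳ-≈; <-respˡ-≈) renaming (trans to <-trans)
  open IntegerSolver commutativeRing
  open Algebra.Properties.Semiring.Mult semiring using (×-homo-+; ×1-homo-*; ×-cong; ×-assoc-*; ×-congʳ) renaming (_×_ to _×ⁿ_)
  open Relation.Binary.Reasoning.Setoid setoid

  Nonneg : Carrier → Set ℓ₂
  Nonneg x = ¬ x < 0#

  x*y≈0⇒y≈0 : ∀ {x y} → ¬ x ≈ 0# → x * y ≈ 0# → y ≈ 0#
  x*y≈0⇒y≈0 {x} {y} x≉0 xy≈0 = begin
    y             ≈⟨ *-identityˡ y ⟨
    1# * y        ≈⟨ *-congʳ (proj₂ (inverse x x≉0)) ⟨
    i * x * y     ≈⟨ *-assoc i x y ⟩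
    i * (x * y)   ≈⟨ *-congˡ xy≈0 ⟩
    i * 0#        ≈⟨ zeroʳ i ⟩
    0#            ∎
    where
    i : Carrier
    i = proj₁ (inverse x x≉0)

  x<0⇒0<-x : ∀ {x} → x < 0# → 0# < - x
  x<0⇒0<-x {x} x<0 = <-respˡ-≈ (-‿inverseʳ x) (<-respʳ-≈ (+-identityˡ (- x)) (+-monoˡ-< (- x) x<0))

  square-pos : ∀ {x} → ¬ x ≈ 0# → 0# < x * x
  square-pos {x} x≉0 with compare x 0#
  ... | tri< x<0 _ _ = <-respʳ-≈ (solve 1 (λ x → :- x :* :- x := x :* x) refl x)
                         (*-pos (x<0⇒0<-x x<0) (x<0⇒0<-x x<0))
  ... | tri≈ _ x≈0 _ = contradiction x≈0 x≉0
  ... | tri> _ _ 0<x = *-pos 0<x 0<x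

  square-nonneg : ∀ x → Nonneg (x * x)
  square-nonneg x xx<0 with x ≟ 0#
  ... | yes x≈0 = irrefl (trans (*-congʳ x≈0) (zeroˡ x)) xx<0
  ... | no x≉0  = irrefl refl (<-trans xx<0 (square-pos x≉0))

  pos+nonneg : ∀ {x y} → 0# < x → Nonneg y → 0# < x + y
  pos+nonneg {x} {y} 0<x 0≤y with compare y 0#
  ... | tri< y<0 _ _ = contradiction y<0 0≤y
  ... | tri≈ _ y≈0 _ = <-respʳ-≈ (sym (trans (+-congˡ y≈0) (+-identityʳ x))) 0<x
  ... | tri> _ _ 0<y = <-trans 0<y (<-respˡ-≈ (+-identityˡ y) (+-monoˡ-< y 0<x))

  0<1 : 0# < 1#
  0<1 = <-respʳ-≈ (*-identityˡ 1#) (square-pos (0≉1 ∘ sym))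

  fromℕ : ℕ → Carrier
  fromℕ n = n ×ⁿ 1#

  fromℕ-nonneg : ∀ n → Nonneg (fromℕ n)
  fromℕ-pos    : ∀ n → 0# < fromℕ (suc n)
  fromℕ-nonneg zero    = irrefl refl
  fromℕ-nonneg (suc n) n<0 = irrefl refl (<-trans n<0 (fromℕ-pos n))
  fromℕ-pos n = pos+nonneg 0<1 (fromℕ-nonneg n)

  fromℕ≈0⇒≡0 : ∀ n → fromℕ n ≈ 0# → n ≡ 0
  fromℕ≈0⇒≡0 zero    _ = ≡.refl
  fromℕ≈0⇒≡0 (suc n) n≈0 = contradiction (fromℕ-pos n) (irrefl (sym n≈0))

  ×ⁿ≈fromℕ* : ∀ n x → n ×ⁿ x ≈ fromℕ n * x
  ×ⁿ≈fromℕ* n x = sym (trans (×-assoc-* n 1# x) (×-congʳ n (*-identityˡ x)))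

  -- Complex zeros of the factored cubic.

  module ℂ where
    open RawRing (ℂ-rawRing F) public
    open Algebra.Definitions.RawSemiring rawSemiring public
      using (sum; _^_) renaming (_×_ to _×ⁿ_)

  ℂ-+-commutativeMonoid : CommutativeMonoid c ℓ₁
  ℂ-+-commutativeMonoid = DirectProduct.commutativeMonoid +-commutativeMonoid +-commutativeMonoid

  proj₁-×ⁿ : ∀ n z → proj₁ (n ℂ.×ⁿ z) ≡ n ×ⁿ proj₁ z
  proj₁-×ⁿ zero    z = ≡.refl
  proj₁-×ⁿ (suc n) z = ≡.cong (proj₁ z +_) (proj₁-×ⁿ n z)

  proj₂-×ⁿ : ∀ n z → proj₂ (n ℂ.×ⁿ z) ≡ n ×ⁿ proj₂ z
  proj₂-×ⁿ zero    z = ≡.refl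
  proj₂-×ⁿ (suc n) z = ≡.cong (proj₂ z +_) (proj₂-×ⁿ n z)

  cubic : (ℕ → ℕ) → ℂ.Carrier → ℂ.Carrier
  cubic A w = ℂ.sum {4} λ j → A (toℕ j) ℂ.×ⁿ (w ℂ.^ toℕ j)

  module _ (a s c : Carrier) where

    -- A linear form in a sequence `t` rather than a polynomial: inserting the real or the imaginary
    -- parts of the powers of w gives that part of the cubic. The final `0#` matches the unfolded
    -- four-term sum.
    cubicForm : (ℕ → Carrier) → Carrier
    cubicForm t = c * t 0 + ((s + c) * t 1 + ((a + s) * t 2 + (a * t 3 + 0#)))

    quadraticForm : (ℕ → Carrier) → Carrier
    quadraticForm t = c * t 0 + s * t 1 + a * t 2

    -- On sequences of powers, multiplication by w + 1 is adding the shifted sequence.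
    cubicForm-step : ∀ t → cubicForm t ≈ quadraticForm (λ j → t j + t (suc j))
    cubicForm-step t = solve 7 (λ a s c t₀ t₁ t₂ t₃ →
      c :* t₀ :+ ((s :+ c) :* t₁ :+ ((a :+ s) :* t₂ :+ (a :* t₃ :+ con ℤ.0ℤ))) :=
      c :* (t₀ :+ t₁) :+ s :* (t₁ :+ t₂) :+ a :* (t₂ :+ t₃))
      refl a s c (t 0) (t 1) (t 2) (t 3)

    quadraticForm-cong : ∀ {t t′} → (∀ j → t j ≈ t′ j) → quadraticForm t ≈ quadraticForm t′
    quadraticForm-cong t≈t′ = +-cong (+-cong (*-congˡ (t≈t′ 0)) (*-congˡ (t≈t′ 1))) (*-congˡ (t≈t′ 2))

    quadraticForm-linear : ∀ u v t t′ →
      quadraticForm (λ j → u * t j + v * t′ j) ≈ u * quadraticForm t + v * quadraticForm t′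
    quadraticForm-linear u v t t′ = solve 11 (λ a s c u v t₀ t₁ t₂ t₀′ t₁′ t₂′ →
      c :* (u :* t₀ :+ v :* t₀′) :+ s :* (u :* t₁ :+ v :* t₁′) :+ a :* (u :* t₂ :+ v :* t₂′) :=
      u :* (c :* t₀ :+ s :* t₁ :+ a :* t₂) :+ v :* (c :* t₀′ :+ s :* t₁′ :+ a :* t₂′))
      refl a s c u v (t 0) (t 1) (t 2) (t′ 0) (t′ 1) (t′ 2)

    module _ (x y : Carrier) where

      re im : ℕ → Carrier
      re j = proj₁ ((x , y) ℂ.^ j)
      im j = proj₂ ((x , y) ℂ.^ j)

      -- The real and imaginary parts of a w² + s w + c and w + 1 at w = x + i y.
      Q-re Q-im u : Carrier
      Q-re = quadraticForm re
      Q-im = quadraticForm im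
      u    = x + 1#

      re-factor : cubicForm re ≈ u * Q-re + - y * Q-im
      re-factor = trans (cubicForm-step re) (trans (quadraticForm-cong λ j →
        solve 4 (λ x y r i → r :+ (x :* r :- y :* i) := (x :+ con ℤ.1ℤ) :* r :+ :- y :* i) refl x y (re j) (im j))
        (quadraticForm-linear u (- y) re im))

      im-factor : cubicForm im ≈ u * Q-im + y * Q-re
      im-factor = trans (cubicForm-step im) (trans (quadraticForm-cong λ j →
        solve 4 (λ x y r i → i :+ (x :* i :+ y :* r) := (x :+ con ℤ.1ℤ) :* i :+ y :* r) refl x y (re j) (im j))
        (quadraticForm-linear u y im re))

      -- The derivative of the quadratic at `x`; the imaginary part of its value at x + iy is `y`
      -- times this.
      v : Carrier
      v = (a + a) * x + s

      Q-re≈ : Q-re ≈ c + s * x + a * (x * x - y * y)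
      Q-re≈ = solve 5 (λ a s c x y →
        let o = con ℤ.0ℤ; i = con ℤ.1ℤ in
        c :* i :+ s :* (x :* i :- y :* o) :+ a :* (x :* (x :* i :- y :* o) :- y :* (x :* o :+ y :* i)) :=
        c :+ s :* x :+ a :* (x :* x :- y :* y)) refl a s c x y

      Q-im≈ : Q-im ≈ y * v
      Q-im≈ = solve 5 (λ a s c x y →
        let o = con ℤ.0ℤ; i = con ℤ.1ℤ in
        c :* o :+ s :* (x :* o :+ y :* i) :+ a :* (x :* (x :* o :+ y :* i) :+ y :* (x :* i :- y :* o)) :=
        y :* ((a :+ a) :* x :+ s)) refl a s c x y

      -- `e` stands for the discriminant s² - 4ac. At a zero off the real axis every summand on the
      -- right vanishes: `v`, the real part, and the defect of `e`.
      complete-square : ∀ e → (a + a) * y * ((a + a) * y) + e ≈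
        v * v - fromℕ 4 * a * (c + s * x + a * (x * x - y * y)) + (fromℕ 4 * (a * c) + e - s * s)
      complete-square e = solve 6 (λ a s c x y e →
        -- `four` is spelled out so that it evaluates to the unfolding of `fromℕ 4`.
        let i = con ℤ.1ℤ; four = i :+ (i :+ (i :+ (i :+ con ℤ.0ℤ))); v = (a :+ a) :* x :+ s in
        (a :+ a) :* y :* ((a :+ a) :* y) :+ e :=
        v :* v :- four :* a :* (c :+ s :* x :+ a :* (x :* x :- y :* y)) :+ (four :* (a :* c) :+ e :- s :* s))
        refl a s c x y e

      module _ (y≉0 : ¬ y ≈ 0#) (re≈0 : cubicForm re ≈ 0#) (im≈0 : cubicForm im ≈ 0#) where

        ∣w+1∣²≉0 : ¬ y * y + u * u ≈ 0#
        ∣w+1∣²≉0 eq = irrefl (sym eq) (pos+nonneg (square-pos y≉0) (square-nonneg u))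

        -- Multiplying (w + 1) Q by the conjugate of w + 1 leaves |w + 1|² Q, and |w + 1|² is
        -- positive because `y` is nonzero.
        Q-re≈0 : Q-re ≈ 0#
        Q-re≈0 = x*y≈0⇒y≈0 ∣w+1∣²≉0 (begin
          (y * y + u * u) * Q-re                             ≈⟨ solve 4 (λ u y p q →
            (y :* y :+ u :* u) :* p := u :* (u :* p :+ :- y :* q) :+ y :* (u :* q :+ y :* p)) refl u y Q-re Q-im ⟩
          u * (u * Q-re + - y * Q-im) + y * (u * Q-im + y * Q-re)
            ≈⟨ +-cong (*-congˡ (trans (sym re-factor) re≈0)) (*-congˡ (trans (sym im-factor) im≈0)) ⟩
          u * 0# + y * 0#                                    ≈⟨ +-cong (zeroʳ u) (zeroʳ y) ⟩
          0# + 0#                                            ≈⟨ +-identityˡ 0# ⟩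
          0#                                                 ∎)

        Q-im≈0 : Q-im ≈ 0#
        Q-im≈0 = x*y≈0⇒y≈0 ∣w+1∣²≉0 (begin
          (y * y + u * u) * Q-im                             ≈⟨ solve 4 (λ u y p q →
            (y :* y :+ u :* u) :* q := u :* (u :* q :+ y :* p) :+ :- y :* (u :* p :+ :- y :* q)) refl u y Q-re Q-im ⟩
          u * (u * Q-im + y * Q-re) + - y * (u * Q-re + - y * Q-im)
            ≈⟨ +-cong (*-congˡ (trans (sym im-factor) im≈0)) (*-congˡ (trans (sym re-factor) re≈0)) ⟩
          u * 0# + - y * 0#                                  ≈⟨ +-cong (zeroʳ u) (zeroʳ (- y)) ⟩
          0# + 0#                                            ≈⟨ +-identityˡ 0# ⟩
          0#                                                 ∎)

        v≈0 : v ≈ 0#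
        v≈0 = x*y≈0⇒y≈0 y≉0 (trans (sym Q-im≈) Q-im≈0)

        a+a≈0 : ∀ e → Nonneg e → fromℕ 4 * (a * c) + e ≈ s * s → a + a ≈ 0#
        a+a≈0 e 0≤e disc with (a + a) * y ≟ 0#
        ... | yes eq = x*y≈0⇒y≈0 y≉0 (trans (*-comm y (a + a)) eq)
        ... | no neq = contradiction (pos+nonneg (square-pos neq) 0≤e) (irrefl (sym (begin
          (a + a) * y * ((a + a) * y) + e       ≈⟨ complete-square e ⟩
          v * v - fromℕ 4 * a * (c + s * x + a * (x * x - y * y)) + (fromℕ 4 * (a * c) + e - s * s)
            ≈⟨ +-cong (+-cong (*-cong v≈0 v≈0) (-‿cong (*-congˡ (trans (sym Q-re≈) Q-re≈0)))) (+-congʳ disc) ⟩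
          0# * 0# - fromℕ 4 * a * 0# + (s * s - s * s)
            ≈⟨ solve 2 (λ a s → con ℤ.0ℤ :* con ℤ.0ℤ :- a :* con ℤ.0ℤ :+ (s :* s :- s :* s) := con ℤ.0ℤ) refl (fromℕ 4 * a) s ⟩
          0#                                    ∎)))

  -- A zero off the real axis kills the coefficients in turn: completing the square gives α = 0,
  -- then `v` reduces to s, then the real part reduces to c. Characteristic zero carries this back
  -- to ℕ, against `nonzero`.
  cubic-real-rooted : ∀ {A} → RealFactorisation A → ∀ w → cubic A w ℂ.≈ ℂ.0# → proj₂ w ≈ 0#
  cubic-real-rooted {A} (α , s , c , A₀ , A₁ , A₂ , A₃ , disc , nonzero) (x , y) (re≈0 , im≈0) with y ≟ 0#
  ... | yes y≈0 = y≈0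
  ... | no y≉0  = contradiction α+s+c≡0 (ℕ.>⇒≢ nonzero)
    where
    a′ s′ c′ : Carrier
    a′ = fromℕ α
    s′ = fromℕ s
    c′ = fromℕ c

    term : ∀ j z {n x} → A j ≡ n → fromℕ n ≈ x → A j ×ⁿ z ≈ x * z
    term j z A≡ n≈ = trans (×ⁿ≈fromℕ* (A j) z) (*-congʳ (trans (×-cong A≡ refl) n≈))

    form : ∀ t → A 0 ×ⁿ t 0 + (A 1 ×ⁿ t 1 + (A 2 ×ⁿ t 2 + (A 3 ×ⁿ t 3 + 0#))) ≈ cubicForm a′ s′ c′ t
    form t = +-cong (term 0 (t 0) A₀ refl) (+-cong (term 1 (t 1) A₁ (×-homo-+ 1# s c))
      (+-cong (term 2 (t 2) A₂ (×-homo-+ 1# α s)) (+-cong (term 3 (t 3) A₃ refl) refl)))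

    re-form : cubicForm a′ s′ c′ (re a′ s′ c′ x y) ≈ 0#
    re-form = trans (sym (form (re a′ s′ c′ x y))) (trans (reflexive (≡.sym
      (≡.cong₂ _+_ (p 0) (≡.cong₂ _+_ (p 1) (≡.cong₂ _+_ (p 2) (≡.cong (_+ 0#) (p 3))))))) re≈0)
      where
      p : ∀ j → proj₁ (A j ℂ.×ⁿ ((x , y) ℂ.^ j)) ≡ A j ×ⁿ proj₁ ((x , y) ℂ.^ j)
      p j = proj₁-×ⁿ (A j) ((x , y) ℂ.^ j)

    im-form : cubicForm a′ s′ c′ (im a′ s′ c′ x y) ≈ 0#
    im-form = trans (sym (form (im a′ s′ c′ x y))) (trans (reflexive (≡.sym
      (≡.cong₂ _+_ (p 0) (≡.cong₂ _+_ (p 1) (≡.cong₂ _+_ (p 2) (≡.cong (_+ 0#) (p 3))))))) im≈0)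
      where
      p : ∀ j → proj₂ (A j ℂ.×ⁿ ((x , y) ℂ.^ j)) ≡ A j ×ⁿ proj₂ ((x , y) ℂ.^ j)
      p j = proj₂-×ⁿ (A j) ((x , y) ℂ.^ j)

    e : ℕ
    e = s ℕ.* s ℕ.∸ 4 ℕ.* (α ℕ.* c)

    disc′ : fromℕ 4 * (a′ * c′) + fromℕ e ≈ s′ * s′
    disc′ = begin
      fromℕ 4 * (a′ * c′) + fromℕ e                ≈⟨ +-congʳ (*-congˡ (×1-homo-* α c)) ⟨
      fromℕ 4 * fromℕ (α ℕ.* c) + fromℕ e          ≈⟨ +-congʳ (×1-homo-* 4 (α ℕ.* c)) ⟨
      fromℕ (4 ℕ.* (α ℕ.* c)) + fromℕ e            ≈⟨ ×-homo-+ 1# (4 ℕ.* (α ℕ.* c)) e ⟨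
      fromℕ (4 ℕ.* (α ℕ.* c) ℕ.+ e)                ≈⟨ ×-cong (ℕ.m+[n∸m]≡n disc) refl ⟩
      fromℕ (s ℕ.* s)                              ≈⟨ ×1-homo-* s s ⟩
      s′ * s′                                      ∎

    2a≈0 : a′ + a′ ≈ 0#
    2a≈0 = a+a≈0 a′ s′ c′ x y y≉0 re-form im-form (fromℕ e) (fromℕ-nonneg e) disc′

    α≡0 : α ≡ 0
    α≡0 = ℕ.m+n≡0⇒m≡0 α (fromℕ≈0⇒≡0 (α ℕ.+ α) (trans (×-homo-+ 1# α α) 2a≈0))

    s′≈0 : s′ ≈ 0#
    s′≈0 = begin
      s′                    ≈⟨ +-identityˡ s′ ⟨
      0# + s′               ≈⟨ +-congʳ (trans (*-congʳ 2a≈0) (zeroˡ x)) ⟨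
      (a′ + a′) * x + s′    ≈⟨ v≈0 a′ s′ c′ x y y≉0 re-form im-form ⟩
      0#                    ∎

    c′≈0 : c′ ≈ 0#
    c′≈0 = begin
      c′                                            ≈⟨ solve 3 (λ c x t → c := c :+ con ℤ.0ℤ :* x :+ con ℤ.0ℤ :* t) refl c′ x (x * x - y * y) ⟩
      c′ + 0# * x + 0# * (x * x - y * y)            ≈⟨ +-cong (+-congˡ (*-congʳ s′≈0)) (*-congʳ (×-cong α≡0 refl)) ⟨
      c′ + s′ * x + a′ * (x * x - y * y)            ≈⟨ Q-re≈ a′ s′ c′ x y ⟨
      Q-re a′ s′ c′ x y                             ≈⟨ Q-re≈0 a′ s′ c′ x y y≉0 re-form im-form ⟩
      0#                                            ∎

    α+s+c≡0 : α ℕ.+ s ℕ.+ c ≡ 0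
    α+s+c≡0 = ≡.cong₂ ℕ._+_ (≡.cong₂ ℕ._+_ α≡0 (fromℕ≈0⇒≡0 s s′≈0)) (fromℕ≈0⇒≡0 c c′≈0)

-- Subsets and lists.

∣p∪q∣≤∣p∣+∣q∣ : ∀ {n} (p q : Subset n) → ∣ p ∪ q ∣ ≤ ∣ p ∣ ℕ.+ ∣ q ∣
∣p∪q∣≤∣p∣+∣q∣ []            []            = z≤n
∣p∪q∣≤∣p∣+∣q∣ (outside ∷ p) (outside ∷ q) = ∣p∪q∣≤∣p∣+∣q∣ p q
∣p∪q∣≤∣p∣+∣q∣ (outside ∷ p) (inside ∷ q)  =
  ℕ.≤-trans (s≤s (∣p∪q∣≤∣p∣+∣q∣ p q)) (ℕ.≤-reflexive (≡.sym (ℕ.+-suc ∣ p ∣ ∣ q ∣)))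
∣p∪q∣≤∣p∣+∣q∣ (inside ∷ p)  (outside ∷ q) = s≤s (∣p∪q∣≤∣p∣+∣q∣ p q)
∣p∪q∣≤∣p∣+∣q∣ (inside ∷ p)  (inside ∷ q)  =
  s≤s (ℕ.≤-trans (∣p∪q∣≤∣p∣+∣q∣ p q) (ℕ.+-monoʳ-≤ ∣ p ∣ (ℕ.n≤1+n ∣ q ∣)))

subsets-complete : ∀ {m} (S : Subset m) → Any (S ≡_) (subsets m)
subsets-complete []            = here ≡.refl
subsets-complete (inside ∷ S)  = Any.++⁺ˡ (Any.map⁺ (Any.map (≡.cong (inside ∷_)) (subsets-complete S)))
subsets-complete {suc m} (outside ∷ S) = Any.++⁺ʳ (List.map (inside ∷_) (subsets m))
  (Any.map⁺ (Any.map (≡.cong (outside ∷_)) (subsets-complete S)))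

AllPairs-lookup-injective : ∀ {a ℓ} {A : Set a} {_~_ : Rel A ℓ} → Symmetric _~_ →
  ∀ {xs} → AllPairs (λ x y → ¬ x ~ y) xs →
  ∀ i j → List.lookup xs i ~ List.lookup xs j → i ≡ j
AllPairs-lookup-injective ~-sym (px ∷ pxs) zero    zero    _ = ≡.refl
AllPairs-lookup-injective ~-sym (px ∷ pxs) zero    (suc j) r = ⊥-elim (All.lookup px (∈-lookup j) r)
AllPairs-lookup-injective ~-sym (px ∷ pxs) (suc i) zero    r = ⊥-elim (All.lookup px (∈-lookup i) (~-sym r))
AllPairs-lookup-injective ~-sym (px ∷ pxs) (suc i) (suc j) r =
  ≡.cong suc (AllPairs-lookup-injective ~-sym pxs i j r)

-- Dimension of solution spaces.

module Dimension {c ℓ₁ ℓ₂} (F : OrderedField c ℓ₁ ℓ₂) where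
  open OrderedField F hiding (zero)
  open LinearAlgebra F
  open OrderedFieldProperties F using (x*y≈0⇒y≈0)
  open Algebra.Properties.Semiring.Sum semiring
  open Relation.Binary.Reasoning.Setoid setoid

  δ-sym : ∀ {n} (i k : Fin n) → δ i k ≡ δ k i
  δ-sym zero    zero    = ≡.refl
  δ-sym zero    (suc k) = ≡.refl
  δ-sym (suc i) zero    = ≡.refl
  δ-sym (suc i) (suc k) = δ-sym i k

  ·-δ : ∀ {n} (f : Vector Carrier n) k → f · δ k ≈ f k
  ·-δ f k = trans (sum-cong-≋ λ i → *-congˡ (reflexive (δ-sym k i))) (lin-δ f k)

  -- Repeating the case distinction of `cut` makes its dimension compute: it is unchanged if `f`
  -- kills the basis, and otherwise one pivot is lost.
  cut-bound : ∀ {n d} {W W′ : Pred (Vector Carrier n) ℓ₁} (f : Vector Carrier n)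
    (closed : ∀ {x y} r → W x → W y → W (λ k → x k + r * y k))
    (into : ∀ {x} → W x → f · x ≈ 0# → W′ x) (out : ∀ {x} → W′ x → W x × f · x ≈ 0#) (B : Basis W d) →
    d ≤ suc (proj₁ (cut {W′ = W′} f closed into out B))
  cut-bound {d = d} f closed into out B with Fin.any? (λ i → ¬? (f · Basis.vector B i ≟ 0#))
  ... | no _ = ℕ.n≤1+n d
  cut-bound {d = suc d} f closed into out B | yes _ = ℕ.≤-refl

  solution-dim : ∀ {m n} (f : Fin m → Vector Carrier n) S → n ≤ ∣ S ∣ ℕ.+ proj₁ (solutionBasis f S)
  solution-dim {zero}  f []            = ℕ.≤-refl
  solution-dim {suc m} f (outside ∷ S) = solution-dim (f ∘ suc) S
  solution-dim {suc m} {n} f (inside ∷ S) = ℕ.≤-trans (solution-dim (f ∘ suc) S) (ℕ.≤-trans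
    (ℕ.+-monoʳ-≤ ∣ S ∣ (cut-bound (f zero) _ _ _ (proj₂ (solutionBasis (f ∘ suc) S))))
    (ℕ.≤-reflexive (ℕ.+-suc ∣ S ∣ _)))

  NonZeroVector : ∀ {n} → Vector Carrier n → Set ℓ₁
  NonZeroVector x = ¬ (∀ k → x k ≈ 0#)

  nonzero-solution : ∀ {m n} (f : Fin m → Vector Carrier n) → m ℕ.< n →
                     ∃ λ x → NonZeroVector x × ∀ i → f i · x ≈ 0#
  nonzero-solution {m} {n} f m<n = go (proj₂ (solutionBasis f full))
    (ℕ.+-cancelˡ-≤ m _ _ (ℕ.≤-trans (ℕ.≤-reflexive (ℕ.+-comm m 1))
      (ℕ.≤-trans m<n (ℕ.≤-trans (solution-dim f full) (ℕ.≤-reflexive (≡.cong (ℕ._+ proj₁ (solutionBasis f full)) (∣⊤∣≡n m)))))))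
    where
    go : ∀ {d} → Basis (Solutions f full) d → 1 ≤ d → ∃ λ x → NonZeroVector x × ∀ i → f i · x ≈ 0#
    go {suc d} B _ = vector zero
      , (λ v≈0 → 0≉1 (sym (independent (δ zero) (λ k → trans
          (+-cong (trans (*-identityˡ _) (v≈0 k)) (zero-sum _ λ i → zeroˡ (vector (suc i) k))) (+-identityˡ 0#)) zero)))
      , λ i → member zero i ∈⊤
      where open Basis B

  -- In coordinates with respect to `B`, a relation among the `e i` is a solution of `d` homogeneous
  -- equations in `m` unknowns.
  dependent : ∀ {n d m} {W : Pred (Vector Carrier n) ℓ₁} → Basis W d → d ℕ.< m →
              (e : Fin m → Vector Carrier n) → (∀ i → W (e i)) →
              ∃ λ a → NonZeroVector a × ∀ k → lin a e k ≈ 0#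
  dependent {n} {d} {m} B d<m e e∈W =
    let a , a≉0 , M·a≈0 = nonzero-solution (λ j i → M i j) d<m
    in a , a≉0 , λ k → begin
      (sum λ i → a i * e i k)                          ≈⟨ sum-cong-≋ (λ i → *-congˡ (proj₂ (spanning (e i) (e∈W i)) k)) ⟨
      (sum λ i → a i * sum λ j → M i j * vector j k)   ≈⟨ sum-cong-≋ (λ i → *-distribˡ-sum (a i) (λ j → M i j * vector j k)) ⟩
      (sum λ i → sum λ j → a i * (M i j * vector j k)) ≈⟨ ∑-comm (λ i j → a i * (M i j * vector j k)) ⟩
      (sum λ j → sum λ i → a i * (M i j * vector j k)) ≈⟨ sum-cong-≋ (λ j → sum-cong-≋ λ i →
                                                            trans (sym (*-assoc (a i) (M i j) (vector j k))) (*-congʳ (*-comm (a i) (M i j)))) ⟩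
      (sum λ j → sum λ i → M i j * a i * vector j k)   ≈⟨ sum-cong-≋ (λ j → *-distribʳ-sum (vector j k) (λ i → M i j * a i)) ⟨
      (sum λ j → (sum λ i → M i j * a i) * vector j k) ≈⟨ zero-sum _ (λ j → trans (*-congʳ (M·a≈0 j)) (zeroˡ _)) ⟩
      0#                                               ∎
    where
    open Basis B
    M : Fin m → Vector Carrier d
    M i = proj₁ (spanning (e i) (e∈W i))

  dim-mono : ∀ {n d d′} {W W′ : Pred (Vector Carrier n) ℓ₁} → Basis W d → Basis W′ d′ → W ⊆ W′ → d ≤ d′
  dim-mono B B′ W⊆W′ = ℕ.≮⇒≥ λ d′<d →
    let a , a≉0 , lin≈0 = dependent B′ d′<d (Basis.vector B) (λ i → W⊆W′ (Basis.member B i))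
    in a≉0 (Basis.independent B a lin≈0)

  dim≤n : ∀ {n d} {W : Pred (Vector Carrier n) ℓ₁} → Basis W d → d ≤ n
  -- The whole space is presented as the solutions of the empty system.
  dim≤n B = dim-mono B (standardBasis {W = Solutions {0} (λ ()) []} λ _ ()) λ _ ()

  -- Joined to the basis `B`, `x` gives too many vectors for `W′`. In the resulting relation `x` has
  -- a nonzero coefficient, as `B` is independent; applying `f i` kills all other terms and leaves f
  -- i · x = 0.
  dim-⊆-antisym : ∀ {m n d d′} {f : Fin m → Vector Carrier n} {S} {W′ : Pred (Vector Carrier n) ℓ₁} →
    Basis (Solutions f S) d → Basis W′ d′ → Solutions f S ⊆ W′ → d′ ≤ d → W′ ⊆ Solutions f S
  dim-⊆-antisym {n = n} {d} {f = f} {S} {W′} B B′ W⊆W′ d′≤d {x} x∈W′ i i∈S =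
    let a , a≉0 , lin≈0 = dependent B′ (s≤s d′≤d) e e∈W′ in
    x*y≈0⇒y≈0
      (λ a₀≈0 → a≉0 λ
        { zero    → a₀≈0
        ; (suc j) → independent (a ∘ suc) (λ k → trans (sym (+-identityˡ _))
            (trans (+-congʳ (sym (trans (*-congʳ a₀≈0) (zeroˡ (x k))))) (lin≈0 k))) j
        })
      (begin
        a zero * (f i · x)                 ≈⟨ +-identityʳ _ ⟨
        a zero * (f i · x) + 0#            ≈⟨ +-congˡ (zero-sum _ λ j → trans (*-congˡ (member j i i∈S)) (zeroʳ (a (suc j)))) ⟨
        (sum λ j → a j * (f i · e j))      ≈⟨ ·-lin (f i) a e ⟨
        f i · lin a e                      ≈⟨ zero-sum _ (λ k → trans (*-congˡ (lin≈0 k)) (zeroʳ (f i k))) ⟩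
        0#                                 ∎)
    where
    open Basis B
    e : Fin (suc d) → Vector Carrier n
    e zero    = x
    e (suc j) = vector j
    e∈W′ : ∀ j → W′ (e j)
    e∈W′ zero    = x∈W′
    e∈W′ (suc j) = W⊆W′ (member j)

-- The flats of an arrangement form such a lattice.

module ArrangementProperties {c ℓ₁ ℓ₂} {F : OrderedField c ℓ₁ ℓ₂} {n : ℕ} (𝒜 : Arrangement F n) where
  open OrderedField F using (Carrier; _≈_; 0#) renaming (sym to ≈-sym; trans to ≈-trans)
  open Arrangement 𝒜
  open LinearAlgebra F
  open Dimension F

  generator : Flat 𝒜 → Subset size
  generator = List.lookup (generators 𝒜)

  opaque
    flat-any : ∀ S → Any (λ T → ⋂ 𝒜 S ≐ ⋂ 𝒜 T) (generators 𝒜)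
    flat-any S = Any.deduplicate⁺ (_⋂≐?_ 𝒜)
      (λ T≐U S≐U → ≐-trans S≐U (≐-sym T≐U))
      (Any.map (λ { ≡.refl → ≐-refl }) (subsets-complete S))

    flat : Subset size → Flat 𝒜
    flat S = Any.index (flat-any S)

    flat-space : ∀ S → ⋂ 𝒜 S ≐ space 𝒜 (flat S)
    flat-space S = Any.lookup-index (flat-any S)

  -- Deduplication leaves pairwise inequivalent generators, so a space determines its index.
  ≈ᶠ⇒≡ : ∀ {X Y} → _≈ᶠ_ 𝒜 X Y → X ≡ Y
  ≈ᶠ⇒≡ {X} {Y} = AllPairs-lookup-injective ≐-sym (deduplicate-! decSetoid (subsets size)) X Y
    where
    decSetoid : DecSetoid _ _
    decSetoid = record
      { Carrier = Subset size
      ; _≈_ = λ S T → ⋂ 𝒜 S ≐ ⋂ 𝒜 T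
      ; isDecEquivalence = record
        { isEquivalence = record { refl = ≐-refl ; sym = ≐-sym ; trans = ≐-trans }
        ; _≟_ = _⋂≐?_ 𝒜
        }
      }

  ≤ᶠ∧codim≤⇒≡ : ∀ {X Y} → _≤ᶠ_ 𝒜 X Y → codim 𝒜 X ≤ codim 𝒜 Y → X ≡ Y
  ≤ᶠ∧codim≤⇒≡ {X} {Y} X≤Y codim≤ = ≈ᶠ⇒≡ (X≤Y ,
    dim-⊆-antisym {S = generator X} (proj₂ (space-basis 𝒜 X)) (proj₂ (space-basis 𝒜 Y)) X≤Y
      (ℕ.∸-cancelʳ-≤ (dim≤n (proj₂ (space-basis 𝒜 Y))) codim≤))

  -- Each equation costs at most one dimension. The dimension of `flat S` is computed from its
  -- chosen generator, possibly not `S`, so `dim-mono` links the two.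
  codim-flat : ∀ S → codim 𝒜 (flat S) ≤ ∣ S ∣
  codim-flat S = ℕ.m≤n+o⇒m∸n≤o n (dim 𝒜 (flat S)) (ℕ.≤-trans
    (solution-dim normal S) (ℕ.≤-trans
      (ℕ.+-monoʳ-≤ ∣ S ∣ (dim-mono (proj₂ (solutionBasis normal S)) (proj₂ (space-basis 𝒜 (flat S))) (proj₁ (flat-space S))))
      (ℕ.≤-reflexive (ℕ.+-comm ∣ S ∣ _))))

  ⊤ᶠ : Flat 𝒜
  ⊤ᶠ = flat ∅

  ⊥ᶠ-minimum : ∀ X → _≤ᶠ_ 𝒜 (⊥ᶠ 𝒜) X
  ⊥ᶠ-minimum X x∈⊥ i _ = proj₂ (Any.lookup-index (⊥-generator 𝒜)) x∈⊥ i ∈⊤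

  ⊤ᶠ-universal : ∀ x → space 𝒜 ⊤ᶠ x
  ⊤ᶠ-universal x = proj₁ (flat-space ∅) λ i i∈∅ → contradiction i∈∅ ∉⊥

  codim-⊤ᶠ : codim 𝒜 ⊤ᶠ ≡ 0
  codim-⊤ᶠ = ℕ.n≤0⇒n≡0 (ℕ.≤-trans (codim-flat ∅) (ℕ.≤-reflexive (∣⊥∣≡0 size)))

  hyperflat : Fin size → Flat 𝒜
  hyperflat i = flat ⁅ i ⁆

  ∈hyperflat⁺ : ∀ {i x} → normal i · x ≈ 0# → space 𝒜 (hyperflat i) x
  ∈hyperflat⁺ {i} ix = proj₁ (flat-space ⁅ i ⁆) λ j j∈ → ≡.subst (λ j → normal j · _ ≈ 0#) (≡.sym (x∈⁅y⁆⇒x≡y i j∈)) ix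

  ∈hyperflat⁻ : ∀ {i x} → space 𝒜 (hyperflat i) x → normal i · x ≈ 0#
  ∈hyperflat⁻ {i} x∈ = proj₂ (flat-space ⁅ i ⁆) x∈ i (x∈⁅x⁆ i)

  -- Codimension 0 would make the hyperplane the whole space; testing its normal on the standard
  -- vectors `δ k` would then show that the normal is zero.
  codim-hyperflat : ∀ i → codim 𝒜 (hyperflat i) ≡ 1
  codim-hyperflat i = ℕ.≤-antisym
    (ℕ.≤-trans (codim-flat ⁅ i ⁆) (ℕ.≤-reflexive (∣⁅x⁆∣≡1 i)))
    (ℕ.n≢0⇒n>0 λ codim≡0 → normal-nonzero i λ k → ≈-trans (≈-sym (·-δ (normal i) k))
      (∈hyperflat⁻ (≡.subst (λ X → space 𝒜 X (δ k))
        (≡.sym (≤ᶠ∧codim≤⇒≡ (λ _ → ⊤ᶠ-universal _) (ℕ.≤-trans (ℕ.≤-reflexive codim≡0) z≤n)))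
        (⊤ᶠ-universal (δ k)))))

  above : ∀ X → X ≢ ⊤ᶠ → ∃ λ i → _≤ᶠ_ 𝒜 X (hyperflat i)
  above X X≢⊤ = go (Fin.any? (_∈? generator X))
    where
    go : Dec (∃ (_∈ generator X)) → ∃ λ i → _≤ᶠ_ 𝒜 X (hyperflat i)
    go (yes (i , i∈S)) = i , λ x∈X → ∈hyperflat⁺ (x∈X i i∈S)
    go (no empty)      = contradiction
      (≈ᶠ⇒≡ ((λ _ → ⊤ᶠ-universal _) , λ _ i i∈S → contradiction (i , i∈S) empty)) X≢⊤

  codim≡1⇒hyperflat : ∀ {X} → codim 𝒜 X ≡ 1 → ∃ λ i → X ≡ hyperflat i
  codim≡1⇒hyperflat {X} codim≡1 =
    let i , X≤Hᵢ = above X λ X≡⊤ → contradiction (≡.trans (≡.sym codim≡1) (≡.trans (≡.cong (codim 𝒜) X≡⊤) codim-⊤ᶠ)) λ ()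
    in i , ≤ᶠ∧codim≤⇒≡ X≤Hᵢ (ℕ.≤-reflexive (≡.trans codim≡1 (≡.sym (codim-hyperflat i))))

  avoiding : ∀ X → X ≢ ⊥ᶠ 𝒜 → ∃ λ h → codim 𝒜 h ≡ 1 × ¬ _≤ᶠ_ 𝒜 X h
  avoiding X X≢⊥ = go (Fin.any? (λ i → ¬? (X≤?H i)))
    where
    X≤?H : ∀ i → Dec (_≤ᶠ_ 𝒜 X (hyperflat i))
    X≤?H i = _⋂⊆?_ 𝒜 (generator X) (generator (hyperflat i))

    X≤⊥ : ¬ (∃ λ i → ¬ _≤ᶠ_ 𝒜 X (hyperflat i)) → _≤ᶠ_ 𝒜 X (⊥ᶠ 𝒜)
    X≤⊥ none x∈X = proj₁ (Any.lookup-index (⊥-generator 𝒜)) λ i _ →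
      -- The failed search only refutes non-containment; decidability of inclusion turns this into
      -- containment.
      ∈hyperflat⁻ (decidable-stable (X≤?H i) (λ X≰Hᵢ → none (i , X≰Hᵢ)) x∈X)

    go : Dec (∃ λ i → ¬ _≤ᶠ_ 𝒜 X (hyperflat i)) → ∃ λ h → codim 𝒜 h ≡ 1 × ¬ _≤ᶠ_ 𝒜 X h
    go (yes (i , X≰Hᵢ)) = hyperflat i , codim-hyperflat i , X≰Hᵢ
    go (no none)        = contradiction (≈ᶠ⇒≡ (X≤⊥ none , ⊥ᶠ-minimum X)) X≢⊥

  Meet : Flat 𝒜 → Flat 𝒜 → Set _
  Meet h h′ = ∃ λ m → codim 𝒜 m ≡ 2 × _≤ᶠ_ 𝒜 m h × _≤ᶠ_ 𝒜 m h′ ×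
              (∀ p → _≤ᶠ_ 𝒜 p h → _≤ᶠ_ 𝒜 p h′ → _≤ᶠ_ 𝒜 p m)

  -- Two equations bound the codimension by 2. Were it at most 1, the intersection would equal the
  -- first hyperplane, which would then lie in the second and coincide with it.
  hyperflat-meet : ∀ i j → hyperflat i ≢ hyperflat j → Meet (hyperflat i) (hyperflat j)
  hyperflat-meet i j Hᵢ≢Hⱼ = m , ℕ.≤-antisym codim≤2 2≤codim , m≤Hᵢ , m≤Hⱼ , greatest
    where
    m : Flat 𝒜
    m = flat (⁅ i ⁆ ∪ ⁅ j ⁆)

    codim≤2 : codim 𝒜 m ≤ 2
    codim≤2 = ℕ.≤-trans (codim-flat (⁅ i ⁆ ∪ ⁅ j ⁆)) (ℕ.≤-trans (∣p∪q∣≤∣p∣+∣q∣ ⁅ i ⁆ ⁅ j ⁆)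
      (ℕ.≤-reflexive (≡.cong₂ ℕ._+_ (∣⁅x⁆∣≡1 i) (∣⁅x⁆∣≡1 j))))

    m≤Hᵢ : _≤ᶠ_ 𝒜 m (hyperflat i)
    m≤Hᵢ x∈m = ∈hyperflat⁺ (proj₂ (flat-space (⁅ i ⁆ ∪ ⁅ j ⁆)) x∈m i (x∈p∪q⁺ (inj₁ (x∈⁅x⁆ i))))

    m≤Hⱼ : _≤ᶠ_ 𝒜 m (hyperflat j)
    m≤Hⱼ x∈m = ∈hyperflat⁺ (proj₂ (flat-space (⁅ i ⁆ ∪ ⁅ j ⁆)) x∈m j (x∈p∪q⁺ (inj₂ (x∈⁅x⁆ j))))

    greatest : ∀ p → _≤ᶠ_ 𝒜 p (hyperflat i) → _≤ᶠ_ 𝒜 p (hyperflat j) → _≤ᶠ_ 𝒜 p m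
    greatest p p≤Hᵢ p≤Hⱼ {x} x∈p = proj₁ (flat-space (⁅ i ⁆ ∪ ⁅ j ⁆)) λ l l∈ → on l (x∈p∪q⁻ ⁅ i ⁆ ⁅ j ⁆ l∈)
      where
      on : ∀ l → l ∈ ⁅ i ⁆ ⊎ l ∈ ⁅ j ⁆ → normal l · x ≈ 0#
      on l (inj₁ l∈) = ≡.subst (λ l → normal l · x ≈ 0#) (≡.sym (x∈⁅y⁆⇒x≡y i l∈)) (∈hyperflat⁻ (p≤Hᵢ x∈p))
      on l (inj₂ l∈) = ≡.subst (λ l → normal l · x ≈ 0#) (≡.sym (x∈⁅y⁆⇒x≡y j l∈)) (∈hyperflat⁻ (p≤Hⱼ x∈p))

    2≤codim : 2 ≤ codim 𝒜 m
    2≤codim = ℕ.≰⇒> λ codim≤1 → Hᵢ≢Hⱼ (≤ᶠ∧codim≤⇒≡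
      (≡.subst (λ X → _≤ᶠ_ 𝒜 X (hyperflat j))
        (≤ᶠ∧codim≤⇒≡ m≤Hᵢ (ℕ.≤-trans codim≤1 (ℕ.≤-reflexive (≡.sym (codim-hyperflat i))))) m≤Hⱼ)
      (ℕ.≤-reflexive (≡.trans (codim-hyperflat i) (≡.sym (codim-hyperflat j)))))

  meet : ∀ {h h′} → codim 𝒜 h ≡ 1 → codim 𝒜 h′ ≡ 1 → h ≢ h′ → Meet h h′
  meet codim-h codim-h′ h≢h′ =
    let i , h≡Hᵢ  = codim≡1⇒hyperflat codim-h
        j , h′≡Hⱼ = codim≡1⇒hyperflat codim-h′
    in ≡.subst₂ Meet (≡.sym h≡Hᵢ) (≡.sym h′≡Hⱼ)
         (hyperflat-meet i j (≡.subst₂ _≢_ h≡Hᵢ h′≡Hⱼ h≢h′))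

  flatLattice : HyperplaneLattice (≤ᶠ-isDecPartialOrder 𝒜)
  flatLattice = record
    { ≈⇒≡ = ≈ᶠ⇒≡
    ; corank = codim 𝒜
    ; ⊥ = ⊥ᶠ 𝒜
    ; ⊤ = ⊤ᶠ
    ; ⊥-minimum = ⊥ᶠ-minimum
    ; ⊤-maximum = λ _ _ → ⊤ᶠ-universal _
    ; corank-⊤ = codim-⊤ᶠ
    ; ≼∧corank≤⇒≡ = ≤ᶠ∧codim≤⇒≡
    ; hyperplane-above = λ X X≢⊤ → let i , X≤Hᵢ = above X X≢⊤ in hyperflat i , codim-hyperflat i , X≤Hᵢ
    ; hyperplane-avoiding = avoiding
    ; hyperplane-meet = meet
    }

-- Real-rootedness for arrangements.

module _ {c ℓ₁ ℓ₂} (F : OrderedField c ℓ₁ ℓ₂) {n : ℕ} (𝒜 : Arrangement F n) where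
  open OrderedField F hiding (zero)
  open OrderedFieldProperties F
  open ArrangementProperties 𝒜
  open HyperplaneLattice flatLattice using (coefficient; coefficient-rank; corank≤rank; coefficient-factorisation)
  open IntegerSolver commutativeRing using (solve; con; _:-_; _:=_)
  open Relation.Binary.Reasoning.Setoid setoid
  open GroupedSum ℂ-+-commutativeMonoid using (group-by-degree)

  P-coefficients : ∀ k z → rank 𝒜 ℕ.< k →
    P 𝒜 z ℂ.≈ ℂ.sum {k} λ j → coefficient (toℕ j) ℂ.×ⁿ ((z ℂ.+ ℂ.- ℂ.1#) ℂ.^ toℕ j)
  P-coefficients k z rank<k = group-by-degree k (λ X → ℤ.∣ μ 𝒜 (⊥ᶠ 𝒜) X ∣) (codim 𝒜) ((z ℂ.+ ℂ.- ℂ.1#) ℂ.^_)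
    λ X → ℕ.≤-<-trans (corank≤rank X) rank<k

  -- The polynomial is the constant 1, so a zero would give 0 = 1.
  P-real-rooted-0 : rank 𝒜 ≡ 0 → RealRooted F (P 𝒜)
  P-real-rooted-0 rank≡0 z (re≈0 , _) = contradiction (begin
    0#                                              ≈⟨ re≈0 ⟨
    proj₁ (P 𝒜 z)                                   ≈⟨ proj₁ (P-coefficients 1 z (s≤s (ℕ.≤-reflexive rank≡0))) ⟩
    proj₁ (coefficient 0 ℂ.×ⁿ ℂ.1#) + 0#            ≡⟨ ≡.cong (λ a → proj₁ (a ℂ.×ⁿ ℂ.1#) + 0#) (coefficient-rank rank≡0) ⟩
    1# + 0# + 0#                                    ≈⟨ trans (+-identityʳ (1# + 0#)) (+-identityʳ 1#) ⟩
    1#                                              ∎) 0≉1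

  P-real-rooted-1+ : rank 𝒜 ≢ 0 → rank 𝒜 ≤ 3 → RealRooted F (P 𝒜)
  P-real-rooted-1+ rank≢0 rank≤3 z (re≈0 , im≈0) =
    -- Passing from z to z - 1 subtracts the imaginary part 0 of 1, so the two imaginary parts
    -- agree.
    trans (solve 1 (λ y → y := y :- con ℤ.0ℤ) refl (proj₂ z))
      (cubic-real-rooted {A = coefficient} (coefficient-factorisation rank≤3 rank≢0) (z ℂ.+ ℂ.- ℂ.1#)
        (trans (sym (proj₁ grouped)) re≈0 , trans (sym (proj₂ grouped)) im≈0))
    where
    grouped : P 𝒜 z ℂ.≈ cubic coefficient (z ℂ.+ ℂ.- ℂ.1#)
    grouped = P-coefficients 4 z (s≤s rank≤3)

  P-real-rooted : rank 𝒜 ≤ 3 → RealRooted F (P 𝒜)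
  P-real-rooted rank≤3 = go (rank 𝒜 ≟ℕ 0)
    where
    go : Dec (rank 𝒜 ≡ 0) → RealRooted F (P 𝒜)
    go (yes rank≡0) = P-real-rooted-0 rank≡0
    go (no rank≢0)  = P-real-rooted-1+ rank≢0 rank≤3

theorem9p1 : ∀ {c ℓ₁ ℓ₂} (ℝ : CompleteOrderedField c ℓ₁ ℓ₂) →
    let F = CompleteOrderedField.orderedField ℝ in
    ∀ (n : ℕ) (𝒜 : Arrangement F n) →
    rank 𝒜 ≤ 3 → RealRooted F (P 𝒜)
theorem9p1 ℝ n 𝒜 = P-real-rooted (CompleteOrderedField.orderedField ℝ) 𝒜
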